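{- Let $k\geq 2$, let $n\geq 1$, let $r$ be a positive integer with $r\leq\frac{(k-1)(2n)}{k}$, and let $\mathcal{F}\subseteq\mathcal{H}^r(M_n)$ be $k$-wise intersecting. Then $$|\mathcal{F}|\leq\begin{cases}2^{r-1}\binom{n-1}{r-1} & \text{if } r\leq n,\\ 2^{2n-r}\binom{n-1}{r-n-1}+2^{2n-r-1}\binom{n-1}{r-n} & \text{otherwise.}\end{cases}$$ If moreover $r<\frac{(k-1)(2n)}{k}$, then equality holds if and only if $\mathcal{F}=\mathcal{H}^r_x(M_n)$ for some vertex $x$ of $M_n$.
   Context: $M_n$ is the perfect matching graph on $2n$ vertices: vertex set $\{1,\dots,2n\}$ and edge set $\{\{i,n+i\}: 1\leq i\leq n\}$. For a graph $G$ and $r\geq1$, $\mathcal{I}^r(G)$ is the family of independent vertex sets of size $r$, $\mathcal{M}^r(G)$ is the family of vertex sets of size $r$ containing a maximum independent set of $G$, and $\mathcal{H}^r(G)=\mathcal{I}^r(G)\cup\mathcal{M}^r(G)$. For a vertex $x$, $\mathcal{H}^r_x(G)=\{A\in\mathcal{H}^r(G): x\in A\}$. A family $\mathcal{F}$ of sets is $k$-wise intersecting if any $k$ members of $\mathcal{F}$ have a common element. -}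

module Defs where

open import Data.Nat using (ℕ; _+_; _*_; _∸_; _^_; _≤_; _≤ᵇ_)
open import Data.Nat.Combinatorics using (_C_)
open import Data.Bool using (if_then_else_)
open import Data.Fin using (Fin; _↑ˡ_; _↑ʳ_)
open import Data.Fin.Subset using (Subset; _∈_; _⊆_; ∣_∣)
open import Data.Product using (Σ; _×_; ∃)
open import Data.Sum using (_⊎_)
open import Data.List using (List)
import Data.List.Membership.Propositional as L
open import Function.Bundles using (_⇔_)
open import Relation.Nullary using (¬_)
open import Relation.Binary.PropositionalEquality using (_≡_)

-- Vertices of M_n: Fin (n + n); vertex i (0-based, i < n) is  i ↑ˡ n,
-- vertex n+i is  n ↑ʳ i.  Edges {i, n+i}.
Edge : (n : ℕ) → Fin (n + n) → Fin (n + n) → Set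
Edge n u v = Σ (Fin n) λ i →
  ((u ≡ i ↑ˡ n) × (v ≡ n ↑ʳ i)) ⊎ ((u ≡ n ↑ʳ i) × (v ≡ i ↑ˡ n))

Independent : (n : ℕ) → Subset (n + n) → Set
Independent n A = ∀ u v → u ∈ A → v ∈ A → ¬ Edge n u v

MaximumIndependent : (n : ℕ) → Subset (n + n) → Set
MaximumIndependent n I = Independent n I × (∀ J → Independent n J → ∣ J ∣ ≤ ∣ I ∣)

ℐ : (n r : ℕ) → Subset (n + n) → Set
ℐ n r A = Independent n A × ∣ A ∣ ≡ r

ℳ : (n r : ℕ) → Subset (n + n) → Set
ℳ n r A = ∣ A ∣ ≡ r × ∃ λ I → MaximumIndependent n I × I ⊆ A

ℋ : (n r : ℕ) → Subset (n + n) → Set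
ℋ n r A = ℐ n r A ⊎ ℳ n r A

ℋₓ : (n r : ℕ) → Fin (n + n) → Subset (n + n) → Set
ℋₓ n r x A = ℋ n r A × x ∈ A

-- k-wise intersecting family (members may repeat among the k chosen)
KWiseIntersecting : {m : ℕ} → ℕ → List (Subset m) → Set
KWiseIntersecting {m} k F =
  (f : Fin k → Subset m) → (∀ i → f i L.∈ F) → ∃ λ (x : Fin m) → ∀ i → x ∈ f i

bound : ℕ → ℕ → ℕ
bound n r = if r ≤ᵇ n
  then 2 ^ (r ∸ 1) * ((n ∸ 1) C (r ∸ 1))
  else 2 ^ (2 * n ∸ r) * ((n ∸ 1) C (r ∸ n ∸ 1))
       + 2 ^ (2 * n ∸ r ∸ 1) * ((n ∸ 1) C (r ∸ n))

{-# OPTIONS --safe #-}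
module Submission where

-- Katona's cycle method.  Arrange the 2n vertices on a cycle with partners antipodal; then
-- every arc of length r belongs to ℋʳ(Mₙ), and averaging over all such arrangements reduces
-- the bound to one cycle.  There, with s = 2n − r, the complements of a k-wise intersecting
-- family of arcs are arcs of length s, no k of which cover the cycle, and k s ≥ 2n: starting
-- from one of them, each residue class modulo s must miss an arc, so at least s starting
-- points are missing.
--
-- If equality holds and k s > 2n, then in every arrangement exactly the arcs through one
-- vertex (the centre) belong to the family.  The centre survives swapping two adjacent
-- edges not containing it, because a member avoiding the centre would lie in a window
-- covered by k − 1 complementary arcs.  Hence it survives all reorderings of the other edges
-- that keep their ends, and these already turn every independent set through the centre
-- into an arc.  For r ≤ n this puts the whole star into the family; for r > n, applied to
-- complements, it puts the family into the star.

open import Defs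
open import Data.Bool using (Bool; T; false; if_then_else_; true)
import Data.Bool.Properties as Boolₚ
open import Data.Empty using (⊥-elim)
import Data.Fin as F
open import Data.Fin using (Fin; _↑ʳ_; _↑ˡ_; fromℕ<; splitAt; toℕ)
import Data.Fin.Properties as Finₚ
open import Data.Fin.Properties
  using (splitAt-↑ʳ; splitAt-↑ˡ; splitAt⁻¹-↑ʳ; splitAt⁻¹-↑ˡ; toℕ-fromℕ<; toℕ-injective; toℕ<n) renaming
    (suc-injective to sucF-injective)
open import Data.Fin.Subset
  using (Subset; _∪_; ⁅_⁆; ∁; ∣_∣; ⊥) renaming (_∈_ to _∈ₛ_; _∉_ to _∉ₛ_; _⊆_ to _⊆ₛ_)
open import Data.Fin.Subset.Properties
  using (x∈p⇒x∉∁p; x∈p∪q⁺; x∈p∪q⁻; x∈⁅x⁆; x∈⁅y⁆⇒x≡y; x∈∁p⇒x∉p; x∉p⇒x∈∁p; x∉∁p⇒x∈p; ∉⊥; ∣∁p∣≡n∸∣p∣;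
    ⊆-antisym) renaming (_∈?_ to _∈ₛ?_)
open import Data.List
  using (List; []; [_]; _++_; _∷_; allFin; applyUpTo; cartesianProductWith; filter; foldr; length; map;
    upTo)
import Data.List.Membership.DecPropositional as DecMem
open import Data.List.Membership.Propositional using (_∈_; _∉_)
open import Data.List.Membership.Propositional.Properties
import Data.List.Properties as Listₚ
open import Data.List.Properties
  using (++-assoc; ++-identityʳ; length-++; length-map; length-tabulate; length-upTo; map-++; map-cong;
    map-id; map-upTo; map-∘; upTo-∷ʳ; ∷-injective; ∷ʳ-injective)
open import Data.List.Relation.Binary.Permutation.Propositional
  using (_↭_; prep; refl; swap; ↭-reflexive; ↭-sym; ↭-trans)
import Data.List.Relation.Binary.Permutation.Propositional.Properties as Perm
import Data.List.Relation.Unary.All as All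
open import Data.List.Relation.Unary.All using (All; []; _∷_)
open import Data.List.Relation.Unary.AllPairs using ([]; _∷_)
open import Data.List.Relation.Unary.Any using (here; there)
import Data.List.Relation.Unary.Unique.DecPropositional as UniqDec
open import Data.List.Relation.Unary.Unique.Propositional using (Unique)
import Data.List.Relation.Unary.Unique.Propositional.Properties as Uniq
open import Data.Nat
open import Data.Nat.Combinatorics using (_C_; k>n⇒nCk≡0; nCk+nC[k+1]≡[n+1]C[k+1]; nCk≡nC[n∸k]; nCn≡1)
open import Data.Nat.DivMod using ([m+kn]%n≡m%n; _%_; _/_; m%n<n; m%n≤n; m<n⇒m%n≡m; m≡m%n+[m/n]*n)
open import Data.Nat.ListAction using (sum)
open import Data.Nat.ListAction.Properties using (sum-++; sum-↭)
open import Data.Nat.Properties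
open import Data.Nat.Tactic.RingSolver using (solve-∀)
open import Data.Product using (_,_; _×_; proj₁; proj₂; uncurry; ∃)
open import Data.Sum using (_⊎_; inj₁; inj₂)
import Data.Vec as Vec
open import Data.Vec using ([]; _∷_; here; there)
import Data.Vec.Properties as Vecₚ
open import Function using (_∘_; id)
open import Function.Bundles using (Equivalence; _⇔_; mk⇔)
open import Relation.Binary.Definitions using (Tri; tri<; tri>; tri≈)
open import Relation.Binary.PropositionalEquality hiding ([_])
open import Relation.Nullary using (Dec; contradiction; does; no; yes; ¬_)
open import Relation.Nullary.Decidable using (_×-dec_; dec-false; dec-true; decidable-stable; ¬?)
open import Relation.Unary using (Decidable)

-- No number of arrangements is ever computed. Each set of ℋʳ is the initial arc of the same number
-- `μ` of words, so `μ` cancels and averaging gives 2n |F| ≤ r |ℋʳ|, whose right side is 2n times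
-- the stated bound. The obstacle in the equality case is that a centre is found separately in each
-- arrangement. A swap of adjacent edges can displace a vertex at either end of an arc. Strictness
-- says that k - 1 complementary arcs cover at least r + 1 positions, one to spare; this suffices
-- unless both ends are disturbed, which happens only for r = n, where k ≥ 3. Edges are never turned
-- round. The price is that an independent set avoiding the edge of the centre, but containing both
-- listed ends and partners of listed ends, is an arc of no arrangement reached. So only sets with
-- the centre on their independent side (the set itself or its complement) are controlled, and each
-- of the two ranges of r yields a single inclusion between family and star. The other one follows
-- by counting, because a star satisfies the averaged inequality with equality.

-- Linear inequalities are checked by cancelling b and comparing both sides as semiring terms.
≤-by : ∀ {a b x y} → a ≤ b → x + b ≡ y + a → x ≤ y
≤-by {a} {b} {x} {y} a≤b eq = +-cancelʳ-≤ b x y (subst (_≤ y + b) (sym eq) (+-monoʳ-≤ y a≤b))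

-- Lists without repetition, indicators and finite sums

module _ {A : Set} where

  unique-⊆⇒↭++ : ∀ {xs ys : List A} → Unique xs → (∀ {x} → x ∈ xs → x ∈ ys) →
    ∃ λ zs → ys ↭ xs ++ zs
  unique-⊆⇒↭++ {[]} {ys} _ _ = ys , refl
  unique-⊆⇒↭++ {x ∷ xs} (x∉xs ∷ u) xs⊆ys with ∈-∃++ (xs⊆ys (here refl))
  ... | as , bs , refl =
    let zs , p = unique-⊆⇒↭++ u λ y∈xs → drop-x (λ { refl → All.lookup x∉xs y∈xs refl }) (xs⊆ys (there y∈xs))
    in zs , ↭-trans (Perm.shift x as bs) (prep x p)
    where
    drop-x : ∀ {y} → ¬ y ≡ x → y ∈ as ++ x ∷ bs → y ∈ as ++ bs
    drop-x y≢x y∈ with ∈-++⁻ as y∈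
    ... | inj₁ y∈as = ∈-++⁺ˡ y∈as
    ... | inj₂ (here y≡x) = contradiction y≡x y≢x
    ... | inj₂ (there y∈bs) = ∈-++⁺ʳ as y∈bs

  unique-⊆⇒length≤ : ∀ {xs ys : List A} → Unique xs → (∀ {x} → x ∈ xs → x ∈ ys) → length xs ≤ length ys
  unique-⊆⇒length≤ {xs} u s =
    let zs , p = unique-⊆⇒↭++ u s
    in subst (length xs ≤_) (sym (trans (Perm.↭-length p) (length-++ xs))) (m≤m+n _ _)

  -- Pigeonhole: the remainder `zs` has no room. This is how an attained count becomes an equality
  -- of families up to order.
  unique-⊆-length≥⇒↭ : ∀ {xs ys : List A} → Unique xs → (∀ {x} → x ∈ xs → x ∈ ys) →
    length ys ≤ length xs → ys ↭ xs
  unique-⊆-length≥⇒↭ {xs} {ys} u s le with unique-⊆⇒↭++ u s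
  ... | [] , p = subst (ys ↭_) (++-identityʳ xs) p
  ... | z ∷ zs , p = contradiction le (<⇒≱ (subst (length xs <_) (sym eq) (m<m+n _ (s≤s z≤n))))
    where
    eq : length ys ≡ length xs + length (z ∷ zs)
    eq = trans (Perm.↭-length p) (length-++ xs)

  filter-¬-++-↭ : ∀ {P : A → Set} (P? : Decidable P) xs → filter P? xs ++ filter (¬? ∘ P?) xs ↭ xs
  filter-¬-++-↭ P? [] = refl
  filter-¬-++-↭ P? (x ∷ xs) with P? x
  ... | yes _ = prep x (filter-¬-++-↭ P? xs)
  ... | no _ = ↭-trans (Perm.shift x (filter P? xs) _) (prep x (filter-¬-++-↭ P? xs))

  Unique-resp-↭ : ∀ {xs ys : List A} → xs ↭ ys → Unique xs → Unique ys
  Unique-resp-↭ refl u = u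
  Unique-resp-↭ (prep x p) (x∉ ∷ u) = Perm.All-resp-↭ p x∉ ∷ Unique-resp-↭ p u
  Unique-resp-↭ (swap x y p) ((x≢y ∷ x∉) ∷ y∉ ∷ u) =
    ((x≢y ∘ sym) ∷ Perm.All-resp-↭ p y∉) ∷ Perm.All-resp-↭ p x∉ ∷ Unique-resp-↭ p u
  Unique-resp-↭ (_↭_.trans p q) u = Unique-resp-↭ q (Unique-resp-↭ p u)

δ : ∀ {P : Set} → Dec P → ℕ
δ d = if does d then 1 else 0

δ-yes : ∀ {P : Set} (d : Dec P) → P → δ d ≡ 1
δ-yes d p rewrite dec-true d p = refl

δ-no : ∀ {P : Set} (d : Dec P) → ¬ P → δ d ≡ 0
δ-no d p rewrite dec-false d p = refl

δ-⇔ : ∀ {P Q : Set} (d : Dec P) (e : Dec Q) → (P → Q) → (Q → P) → δ d ≡ δ e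
δ-⇔ (yes p) e to _ = sym (δ-yes e (to p))
δ-⇔ (no ¬p) e _ from = sym (δ-no e (¬p ∘ from))

abstract
  ∑ : ∀ {A : Set} → List A → (A → ℕ) → ℕ
  ∑ xs f = sum (map f xs)

  ∑-cong : ∀ {A : Set} (xs : List A) {f g : A → ℕ} → (∀ {x} → x ∈ xs → f x ≡ g x) → ∑ xs f ≡ ∑ xs g
  ∑-cong [] e = refl
  ∑-cong (x ∷ xs) e = cong₂ _+_ (e (here refl)) (∑-cong xs (e ∘ there))

  ∑-↭ : ∀ {A : Set} {xs ys : List A} (f : A → ℕ) → xs ↭ ys → ∑ xs f ≡ ∑ ys f
  ∑-↭ f p = sum-↭ (Perm.map⁺ f p)

  ∑-map : ∀ {A : Set} {B : Set} (g : B → A) (xs : List B) (f : A → ℕ) → ∑ (map g xs) f ≡ ∑ xs (f ∘ g)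
  ∑-map g xs f = cong sum (sym (map-∘ xs))

  ∑-const : ∀ {A : Set} (xs : List A) c → ∑ xs (λ _ → c) ≡ length xs * c
  ∑-const [] c = refl
  ∑-const (x ∷ xs) c = cong (c +_) (∑-const xs c)

  ∑-+ : ∀ {A : Set} (xs : List A) (f g : A → ℕ) → ∑ xs (λ x → f x + g x) ≡ ∑ xs f + ∑ xs g
  ∑-+ [] f g = refl
  ∑-+ (x ∷ xs) f g rewrite ∑-+ xs f g = interchange (f x) (g x) (∑ xs f) (∑ xs g)
    where
    interchange : ∀ a b c d → (a + b) + (c + d) ≡ (a + c) + (b + d)
    interchange = solve-∀

  ∑-≤ : ∀ {A : Set} (xs : List A) {f : A → ℕ} {c} → (∀ {x} → x ∈ xs → f x ≤ c) → ∑ xs f ≤ length xs * c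
  ∑-≤ [] le = z≤n
  ∑-≤ (x ∷ xs) le = +-mono-≤ (le (here refl)) (∑-≤ xs (le ∘ there))

  -- No term can make up for a deficit of another one. This passes equality in the averaged bound on
  -- to every single arrangement.
  ∑-≤-tight : ∀ {A : Set} (xs : List A) {f : A → ℕ} {c} → (∀ {x} → x ∈ xs → f x ≤ c) →
    length xs * c ≤ ∑ xs f → ∀ {x} → x ∈ xs → c ≤ f x
  ∑-≤-tight (x ∷ xs) {f} {c} le ge (here refl) =
    +-cancelʳ-≤ (length xs * c) c (f x) (≤-trans ge (+-monoʳ-≤ (f x) (∑-≤ xs (le ∘ there))))
  ∑-≤-tight (x ∷ xs) {f} {c} le ge (there i) =
    ∑-≤-tight xs (le ∘ there) (+-cancelˡ-≤ c _ _ (≤-trans ge (+-monoˡ-≤ (∑ xs f) (le (here refl))))) i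

  ∈⇒≤∑ : ∀ {A : Set} {xs : List A} (f : A → ℕ) {x} → x ∈ xs → f x ≤ ∑ xs f
  ∈⇒≤∑ f (here refl) = m≤m+n _ _
  ∈⇒≤∑ f (there i) = ≤-trans (∈⇒≤∑ f i) (m≤n+m _ _)

  ∑δ+length-filter-¬ : ∀ {A : Set} {P : A → Set} (P? : Decidable P) xs →
    ∑ xs (δ ∘ P?) + length (filter (¬? ∘ P?) xs) ≡ length xs
  ∑δ+length-filter-¬ P? [] = refl
  ∑δ+length-filter-¬ P? (x ∷ xs) with P? x
  ... | yes _ = cong suc (∑δ+length-filter-¬ P? xs)
  ... | no _ = trans (+-suc _ _) (cong suc (∑δ+length-filter-¬ P? xs))

  -- Without repetitions at most one term is 1. Membership in the family thus becomes a sum over the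
  -- family, ready for an exchange of summations.
  ∑δ-unique : ∀ {A : Set} → (_≟ᴬ_ : ∀ (x y : A) → Dec (x ≡ y)) → ∀ {xs x} → Unique xs → (d : Dec (x ∈ xs)) →
    ∑ xs (λ y → δ (x ≟ᴬ y)) ≡ δ d
  ∑δ-unique _≟ᴬ_ {[]} u d = sym (δ-no d λ ())
  ∑δ-unique _≟ᴬ_ {y ∷ xs} {x} (y∉ ∷ u) d with x ≟ᴬ y
  ... | yes refl = trans
        (cong suc (∑δ-unique _≟ᴬ_ u (no λ i → All.lookup y∉ i refl))) (sym (δ-yes d (here refl)))
  ... | no x≢y with d
  ...   | yes (here e) = contradiction e x≢y
  ...   | yes (there i) = ∑δ-unique _≟ᴬ_ u (yes i)
  ...   | no ∉ = ∑δ-unique _≟ᴬ_ u (no (∉ ∘ there))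

  ∑-swap : ∀ {A B : Set} (xs : List A) (ys : List B) (f : A → B → ℕ) →
    ∑ xs (λ x → ∑ ys (f x)) ≡ ∑ ys (λ y → ∑ xs (λ x → f x y))
  ∑-swap [] ys f = sym (trans (∑-const ys 0) (*-zeroʳ (length ys)))
  ∑-swap (x ∷ xs) ys f rewrite ∑-swap xs ys f = sym (∑-+ ys (f x) (λ y → ∑ xs (λ x → f x y)))

  ∑-upTo-suc : ∀ N (f : ℕ → ℕ) → ∑ (upTo (suc N)) f ≡ f 0 + ∑ (upTo N) (f ∘ suc)
  ∑-upTo-suc N f = trans (cong sum (map-upTo f (suc N))) (cong (λ l → f 0 + sum l) (sym (map-upTo (f ∘ suc) N)))

  ∑-upTo-shift : ∀ N (f : ℕ → ℕ) → f N ≡ f 0 → ∑ (upTo N) (f ∘ suc) ≡ ∑ (upTo N) f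
  ∑-upTo-shift N f e = +-cancelˡ-≡ (f 0) _ _ (begin
    f 0 + ∑ (upTo N) (f ∘ suc)       ≡⟨ ∑-upTo-suc N f ⟨
    ∑ (upTo (suc N)) f               ≡⟨ cong (λ l → ∑ l f) (upTo-∷ʳ N) ⟨
    ∑ (upTo N ++ [ N ]) f            ≡⟨ cong sum (map-++ f (upTo N) [ N ]) ⟩
    sum (map f (upTo N) ++ [ f N ])  ≡⟨ sum-++ (map f (upTo N)) [ f N ] ⟩
    ∑ (upTo N) f + (f N + 0)         ≡⟨ cong (∑ (upTo N) f +_) (trans (+-identityʳ (f N)) e) ⟩
    ∑ (upTo N) f + f 0               ≡⟨ +-comm _ (f 0) ⟩
    f 0 + ∑ (upTo N) f ∎)
    where open ≡-Reasoning

  ∑-upTo-≥ : ∀ s r → ∑ (upTo (s + r)) (λ b → δ (s ≤? b)) ≡ r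
  ∑-upTo-≥ zero r = trans (∑-cong (upTo r) (λ {b} _ → δ-yes (0 ≤? b) z≤n))
    (trans (∑-const (upTo r) 1) (trans (*-identityʳ _) (length-upTo r)))
  ∑-upTo-≥ (suc s) r = trans (∑-upTo-suc (s + r) (λ b → δ (suc s ≤? b)))
    (trans (∑-cong (upTo (s + r)) (λ {b} _ → δ-⇔ (suc s ≤? suc b) (s ≤? b) ≤-pred s≤s)) (∑-upTo-≥ s r))

  ∑-upTo-periodic : ∀ N (f : ℕ → ℕ) → (∀ b → f (N + b) ≡ f b) → ∀ a →
    ∑ (upTo N) (λ u → f (a + u)) ≡ ∑ (upTo N) f
  ∑-upTo-periodic N f per zero = refl
  ∑-upTo-periodic N f per (suc a) = trans
    (∑-upTo-periodic N (f ∘ suc) (λ b → trans (cong f (sym (+-suc N b))) (per (suc b))) a)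
    (∑-upTo-shift N f (trans (cong f (sym (+-identityʳ N))) (per 0)))

-- Arcs of a cycle

-- Q b stands for "the complementary arc [b , b + s) of the N-cycle belongs to the family";
-- the hypothesis nocover says that no k = suc k′ such arcs go round the cycle.
module Cycle
  (N s k′ : ℕ) (0<s : 0 < s) (Q : ℕ → Set) (Q? : Decidable Q)
  (periodic : ∀ b → Q b → Q (N + b)) (periodic⁻ : ∀ b → Q (N + b) → Q b)
  (s≤N : s ≤ N) (N≤ks : N ≤ suc k′ * s)
  (nocover : ∀ (b : ℕ → ℕ) → (∀ i → i ≤ k′ → Q (b i)) → (∀ i → b (suc i) ≤ b i + s) →
    b k′ + s < b 0 + N)
  where

  private instance
    s≢0 : NonZero s
    s≢0 = >-nonZero 0<s

  -- Offsets are counted from `a + 1`, so that the last one, `N − 1`, stands for `a` itself one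
  -- period later, which is present in `Base`.
  missing : ℕ → List ℕ
  missing a = filter (λ u → ¬? (Q? (a + suc u))) (upTo N)

  count-from : ∀ a → ∑ (upTo N) (λ b → δ (Q? b)) + length (missing a) ≡ N
  count-from a = begin
    ∑ (upTo N) (λ b → δ (Q? b)) + length (missing a)
      ≡⟨ cong (_+ length (missing a)) (∑-upTo-periodic N _ (λ b → δ-⇔ (Q? (N + b)) (Q? b) (periodic⁻ b) (periodic b)) (suc a)) ⟨
    ∑ (upTo N) (λ u → δ (Q? (suc a + u))) + length (missing a)
      ≡⟨ cong (_+ length (missing a)) (∑-cong (upTo N) λ {u} _ → cong (λ v → δ (Q? v)) (sym (+-suc a u))) ⟩
    ∑ (upTo N) (λ u → δ (Q? (a + suc u))) + length (missing a)
      ≡⟨ ∑δ+length-filter-¬ (λ u → Q? (a + suc u)) (upTo N) ⟩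
    length (upTo N) ≡⟨ length-upTo N ⟩
    N ∎
    where open ≡-Reasoning

  module Base (a : ℕ) (Qa : Q a) where

    QaN : Q (a + N)
    QaN = subst Q (+-comm N a) (periodic a Qa)

    -- Arcs starting in the class of t modulo s, cut off at the period.
    steps : ℕ → ℕ → ℕ
    steps t i = (a + suc (t + i * s)) ⊓ (a + N)

    steps-suc : ∀ t i → steps t (suc i) ≤ steps t i + s
    steps-suc t i = ≤-trans
      (⊓-mono-≤ (≤-reflexive (lemma a s t i)) (m≤m+n (a + N) s))
      (≤-reflexive (sym (+-distribʳ-⊓ s (a + suc (t + i * s)) (a + N))))
      where
      lemma : ∀ a s t i → a + suc (t + (s + i * s)) ≡ a + suc (t + i * s) + s
      lemma = solve-∀

    end : ∀ {m t} → m ≤ a + suc (t + k′ * s) + s → m ≤ a + N + s → m ≤ steps t k′ + s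
    end {m} {t} p q = subst (m ≤_) (sym (+-distribʳ-⊓ s (a + suc (t + k′ * s)) (a + N))) (⊓-glb p q)

    -- A start that was cut off equals `a + N`, which is present; so a missing start is a genuine
    -- member of the class of `t`.
    ¬Q-steps : ∀ {t i} → ¬ Q (steps t i) → t + i * s < N × ¬ Q (a + suc (t + i * s))
    ¬Q-steps {t} {i} ¬Qi with ≤-total (a + suc (t + i * s)) (a + N)
    ... | inj₁ le = +-cancelˡ-≤ a _ _ le , subst (¬_ ∘ Q) (m≤n⇒m⊓n≡m le) ¬Qi
    ... | inj₂ ge = contradiction (subst Q (sym (m≥n⇒m⊓n≡n ge)) QaN) ¬Qi

    abstract
      -- If all k starts `steps t i` were present, their arcs would go round: the last one ends
      -- beyond `a + 1 + t + N`, by `N ≤ k s` if its start is not cut off and by `t < s` if it is.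
      class-missing : ∀ t → t < s → ∃ λ i → (t + i * s) ∈ missing a
      class-missing t t<s with anyUpTo? (λ i → ¬? (Q? (steps t i))) (suc k′)
      ... | yes (i , _ , ¬Qi) = let u<N , ¬Qu = ¬Q-steps {t} {i} ¬Qi
                                in i , ∈-filter⁺ _ (∈-upTo⁺ u<N) ¬Qu
      ... | no none = contradiction
        (nocover (steps t) (λ i i≤k′ → decidable-stable (Q? _) λ ¬Qi → none (i , s≤s i≤k′ , ¬Qi)) (steps-suc t))
        (≤⇒≯ (≤-trans (+-monoˡ-≤ N (m⊓n≤m _ (a + N)))
          (end (≤-by N≤ks (lemma₁ a N t k′ s)) (≤-by t<s (lemma₂ a N t s)))))
        where
        lemma₁ : ∀ a N t k′ s → (a + suc (t + 0 * s) + N) + (s + k′ * s) ≡ (a + suc (t + k′ * s) + s) + N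
        lemma₁ = solve-∀
        lemma₂ : ∀ a N t s → (a + suc (t + 0 * s) + N) + s ≡ (a + N + s) + suc t
        lemma₂ = solve-∀

    miss : Fin s → ℕ
    miss t = toℕ t + proj₁ (class-missing (toℕ t) (toℕ<n t)) * s

    miss% : ∀ t → miss t % s ≡ toℕ t
    miss% t = trans ([m+kn]%n≡m%n (toℕ t) (proj₁ (class-missing (toℕ t) (toℕ<n t))) s) (m<n⇒m%n≡m (toℕ<n t))

    misses : List ℕ
    misses = map miss (allFin s)

    misses-unique : Unique misses
    misses-unique = Uniq.map⁺
      (λ {t} {t′} e → toℕ-injective (trans (sym (miss% t)) (trans (cong (_% s) e) (miss% t′))))
      (Uniq.allFin⁺ s)

    misses⊆missing : ∀ {u} → u ∈ misses → u ∈ missing a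
    misses⊆missing u∈ with ∈-map⁻ miss u∈
    ... | t , _ , refl = proj₂ (class-missing (toℕ t) (toℕ<n t))

    length-misses : length misses ≡ s
    length-misses = trans (length-map miss (allFin s)) (length-tabulate id)

    s≤length-missing : s ≤ length (missing a)
    s≤length-missing = subst (_≤ length (missing a)) length-misses (unique-⊆⇒length≤ misses-unique misses⊆missing)

  count : ℕ
  count = ∑ (upTo N) (λ b → δ (Q? b))

  find-base : 0 < count → ∃ Q
  find-base pos with anyUpTo? Q? N
  ... | yes (a , _ , Qa) = a , Qa
  ... | no none = contradiction pos (≤⇒≯ (≤-reflexive (trans
    (∑-cong (upTo N) λ {b} b∈ → δ-no (Q? b) λ Qb → none (b , ∈-upTo⁻ b∈ , Qb))
    (trans (∑-const (upTo N) 0) (*-zeroʳ (length (upTo N)))))))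

  count-bound : count + s ≤ N
  count-bound with 0 <? count
  ... | yes pos = let a , Qa = find-base pos in
    ≤-trans (+-monoʳ-≤ count (Base.s≤length-missing a Qa)) (≤-reflexive (count-from a))
  -- An empty family offers no base `a`; here `s ≤ N` is all that is claimed.
  ... | no c≯0 = subst (λ c → c + s ≤ N) (sym (n≤0⇒n≡0 (≮⇒≥ c≯0))) s≤N

  module Extremal (1≤k′ : 1 ≤ k′) (N<ks : N < suc k′ * s) (tight : N ≤ count + s) (s<N : s < N) where

    private
      pos : 0 < count
      pos = +-cancelʳ-< s 0 count (≤-trans s<N tight)

    -- Walking from a present start to a missing one crosses from present to missing somewhere.
    -- Based there, offset 0 is missing, which starts the induction of `initial-missing`.
    boundary : ∀ a → Q a → ∀ d → ¬ Q (a + d) → ∃ λ a → Q a × ¬ Q (a + 1)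
    boundary a Qa zero ¬Q = contradiction (subst Q (sym (+-identityʳ a)) Qa) ¬Q
    boundary a Qa (suc d) ¬Q with Q? (a + 1)
    ... | no ¬Q₁ = a , Qa , ¬Q₁
    ... | yes Q₁ = boundary (a + 1) Q₁ d (subst (¬_ ∘ Q) (sym (+-assoc a 1 d)) ¬Q)

    abstract
      ∃boundary : ∃ λ a → Q a × ¬ Q (a + 1)
      ∃boundary =
        let a , Qa = find-base pos
            i , u∈ = Base.class-missing a Qa 0 0<s
        in boundary a Qa (suc (0 + i * s)) (proj₂ (∈-filter⁻ (λ u → ¬? (Q? (a + suc u))) {xs = upTo N} u∈))

    a : ℕ
    a = proj₁ ∃boundary

    private
      Qa : Q a
      Qa = proj₁ (proj₂ ∃boundary)
    open Base a Qa

    -- Tightness allows at most `s` missing offsets, and `misses` already provides `s` distinct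
    -- ones; hence each class modulo `s` misses exactly one.
    missing-mod : ∀ {u} → u < N → ¬ Q (a + suc u) → ∃ λ t → u ≡ miss t
    missing-mod u<N ¬Qu =
      let p = unique-⊆-length≥⇒↭ misses-unique misses⊆missing
                (+-cancelˡ-≤ count _ _ (≤-trans (≤-reflexive (count-from a))
                  (≤-trans tight (≤-reflexive (cong (count +_) (sym length-misses))))))
          t , _ , e = ∈-map⁻ miss (Perm.∈-resp-↭ p (∈-filter⁺ _ (∈-upTo⁺ u<N) ¬Qu))
      in t , e

    missing-unique : ∀ {u v} → u < N → ¬ Q (a + suc u) → v < N → ¬ Q (a + suc v) → u % s ≡ v % s → u ≡ v
    missing-unique u<N ¬Qu v<N ¬Qv e with missing-mod u<N ¬Qu | missing-mod v<N ¬Qv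
    ... | t , refl | t′ , refl = cong miss (toℕ-injective (trans (sym (miss% t)) (trans e (miss% t′))))

    -- Otherwise the arc at a + t + 2, followed by the arcs of the class of t, goes round.
    initial-missing : ∀ t → t < s → ¬ Q (a + suc t)
    initial-missing zero _ = proj₂ (proj₂ ∃boundary)
    initial-missing (suc t) t<s Qt = contradiction (nocover b Qb b-suc) (≤⇒≯ (cover k′ 1≤k′ refl))
      where
      ¬Qt : ¬ Q (a + suc t)
      ¬Qt = initial-missing t (<-trans (n<1+n t) t<s)
      b : ℕ → ℕ
      b zero = a + suc (suc t)
      b (suc i) = steps t (suc i)
      Qb : ∀ i → i ≤ k′ → Q (b i)
      Qb zero _ = Qt
      -- The class of `t` already misses offset `t`; a second missing offset would contradict
      -- `missing-unique`.
      Qb (suc i) _ = decidable-stable (Q? _) λ ¬Qi →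
        let u<N , ¬Qu = ¬Q-steps {t} {suc i} ¬Qi
            t<s′ = <-trans (n<1+n t) t<s
            e = missing-unique u<N ¬Qu (≤-trans t<s′ (<⇒≤ s<N)) ¬Qt ([m+kn]%n≡m%n t (suc i) s)
        in contradiction (≤-reflexive e) (<⇒≱ (m<m+n t (≤-trans 0<s (m≤m+n s (i * s)))))
      b-suc : ∀ i → b (suc i) ≤ b i + s
      b-suc zero = ≤-trans (m⊓n≤m _ (a + N)) (≤-by (z≤n {1}) (lemma a t s))
        where
        lemma : ∀ a t s → (a + suc (t + 1 * s)) + 1 ≡ (a + suc (suc t) + s) + 0
        lemma = solve-∀
      b-suc (suc i) = steps-suc t (suc i)
      cover : ∀ j → 1 ≤ j → j ≡ k′ → b 0 + N ≤ b j + s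
      -- Starting one position later than in `class-missing` costs one unit, paid for by the strict
      -- `N < k s` and by `suc t < s`.
      cover (suc j) _ refl = end {t = t} (≤-by N<ks (lemma₁ a N t k′ s)) (≤-by t<s (lemma₂ a N t s))
        where
        lemma₁ : ∀ a N t k′ s → (a + suc (suc t) + N) + (s + k′ * s) ≡ (a + suc (t + k′ * s) + s) + suc N
        lemma₁ = solve-∀
        lemma₂ : ∀ a N t s → (a + suc (suc t) + N) + s ≡ (a + N + s) + suc (suc t)
        lemma₂ = solve-∀

    -- Every class has spent its only missing offset below `s`, by `initial-missing`.
    later-present : ∀ u → u < N → s ≤ u → Q (a + suc u)
    later-present u u<N s≤u = decidable-stable (Q? _) λ ¬Qu →
      let t , e = missing-mod u<N ¬Qu
          e′ = missing-unique u<N ¬Qu (≤-trans (toℕ<n t) (<⇒≤ s<N)) (initial-missing (toℕ t) (toℕ<n t))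
                 (trans (cong (_% s) e) (trans (miss% t) (sym (m<n⇒m%n≡m (toℕ<n t)))))
      in contradiction s≤u (<⇒≱ (subst (_< s) (sym e′) (toℕ<n t)))

-- Finite subsets and lists without repetition

map-unique-on : ∀ {A B : Set} (f : A → B) {xs : List A} →
  (∀ {x y} → x ∈ xs → y ∈ xs → f x ≡ f y → x ≡ y) → Unique xs → Unique (map f xs)
map-unique-on f inj [] = []
map-unique-on f {x ∷ xs} inj (x∉ ∷ u) =
  All.tabulate (λ v∈ e → let y , y∈ , v≡ = ∈-map⁻ f v∈ in
    All.lookup x∉ y∈ (inj (here refl) (there y∈) (trans e v≡)))
  ∷ map-unique-on f (λ i j → inj (there i) (there j)) u

unique-map-inj : ∀ {A B : Set} (f : A → B) {xs : List A} → Unique (map f xs) →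
  ∀ {x y} → x ∈ xs → y ∈ xs → f x ≡ f y → x ≡ y
unique-map-inj f (x∉ ∷ u) (here refl) (here refl) e = refl
unique-map-inj f (x∉ ∷ u) (here refl) (there j) e = contradiction e (All.lookup x∉ (∈-map⁺ f j))
unique-map-inj f (x∉ ∷ u) (there i) (here refl) e = contradiction (sym e) (All.lookup x∉ (∈-map⁺ f i))
unique-map-inj f (x∉ ∷ u) (there i) (there j) e = unique-map-inj f u i j e

unique-full : ∀ {m} {xs : List (Fin m)} → Unique xs → m ≤ length xs → ∀ i → i ∈ xs
unique-full {m} {xs} u le i = Perm.∈-resp-↭
  (unique-⊆-length≥⇒↭ u (λ _ → ∈-allFin _) (subst (_≤ length xs) (sym (length-tabulate id)) le))
  (∈-allFin i)

setOf : ∀ {m} → List (Fin m) → Subset m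
setOf = foldr (λ x A → ⁅ x ⁆ ∪ A) ⊥

∈-setOf⁺ : ∀ {m} {xs : List (Fin m)} {v} → v ∈ xs → v ∈ₛ setOf xs
∈-setOf⁺ {xs = x ∷ xs} (here refl) = x∈p∪q⁺ (inj₁ (x∈⁅x⁆ x))
∈-setOf⁺ (there i) = x∈p∪q⁺ (inj₂ (∈-setOf⁺ i))

∈-setOf⁻ : ∀ {m} {xs : List (Fin m)} {v} → v ∈ₛ setOf xs → v ∈ xs
∈-setOf⁻ {xs = []} i = contradiction i ∉⊥
∈-setOf⁻ {xs = x ∷ xs} i with x∈p∪q⁻ ⁅ x ⁆ (setOf xs) i
... | inj₁ p = here (x∈⁅y⁆⇒x≡y x p)
... | inj₂ p = there (∈-setOf⁻ p)

elems : ∀ {m} → Subset m → List (Fin m)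
elems [] = []
elems (true ∷ A) = F.zero ∷ map F.suc (elems A)
elems (false ∷ A) = map F.suc (elems A)

∈-elems⁺ : ∀ {m} {A : Subset m} {v} → v ∈ₛ A → v ∈ elems A
∈-elems⁺ {A = true ∷ A} here = here refl
∈-elems⁺ {A = true ∷ A} (there i) = there (∈-map⁺ F.suc (∈-elems⁺ i))
∈-elems⁺ {A = false ∷ A} (there i) = ∈-map⁺ F.suc (∈-elems⁺ i)

∈-elems⁻ : ∀ {m} {A : Subset m} {v} → v ∈ elems A → v ∈ₛ A
∈-elems⁻ {A = true ∷ A} (here refl) = here
∈-elems⁻ {A = true ∷ A} (there i) with ∈-map⁻ F.suc i
... | _ , j , refl = there (∈-elems⁻ j)
∈-elems⁻ {A = false ∷ A} i with ∈-map⁻ F.suc i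
... | _ , j , refl = there (∈-elems⁻ j)

elems-unique : ∀ {m} (A : Subset m) → Unique (elems A)
elems-unique [] = []
elems-unique (true ∷ A) =
  All.tabulate (λ i e → absurd (trans e (proj₂ (proj₂ (∈-map⁻ F.suc i))))) ∷ Uniq.map⁺ sucF-injective (elems-unique A)
  where
  absurd : ∀ {m} {i : Fin m} {P : Set} → F.zero ≡ F.suc i → P
  absurd ()
elems-unique (false ∷ A) = Uniq.map⁺ sucF-injective (elems-unique A)

length-elems : ∀ {m} (A : Subset m) → length (elems A) ≡ ∣ A ∣
length-elems [] = refl
length-elems (true ∷ A) = cong suc (trans (length-map F.suc (elems A)) (length-elems A))
length-elems (false ∷ A) = trans (length-map F.suc (elems A)) (length-elems A)

length-unique≡∣∣ : ∀ {m} {A : Subset m} {xs} → Unique xs →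
  (∀ {v} → v ∈ xs → v ∈ₛ A) → (∀ {v} → v ∈ₛ A → v ∈ xs) → length xs ≡ ∣ A ∣
length-unique≡∣∣ {A = A} u to from = trans
  (≤-antisym (unique-⊆⇒length≤ u (∈-elems⁺ ∘ to)) (unique-⊆⇒length≤ (elems-unique A) (from ∘ ∈-elems⁻)))
  (length-elems A)

⊆∧∣∣≥⇒≡ : ∀ {m} {A B : Subset m} → A ⊆ₛ B → ∣ B ∣ ≤ ∣ A ∣ → A ≡ B
⊆∧∣∣≥⇒≡ {A = A} {B} A⊆B le = ⊆-antisym A⊆B λ v∈B → ∈-elems⁻ (Perm.∈-resp-↭
  (unique-⊆-length≥⇒↭ (elems-unique A) (∈-elems⁺ ∘ A⊆B ∘ ∈-elems⁻)
    (subst₂ _≤_ (sym (length-elems B)) (sym (length-elems A)) le))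
  (∈-elems⁺ v∈B))

∁-involutive : ∀ {m} (A : Subset m) → ∁ (∁ A) ≡ A
∁-involutive A = ⊆-antisym (λ i → x∉∁p⇒x∈p (x∈∁p⇒x∉p i)) (λ i → x∉p⇒x∈∁p (x∈p⇒x∉∁p i))

-- Pairs of disjoint subsets

∈-++ˡ⁺ : ∀ {m k} {A : Subset m} {B : Subset k} {i} → i ∈ₛ A → (i ↑ˡ k) ∈ₛ A Vec.++ B
∈-++ˡ⁺ here = here
∈-++ˡ⁺ (there p) = there (∈-++ˡ⁺ p)

∈-++ˡ⁻ : ∀ {m k} {A : Subset m} {B : Subset k} {i} → (i ↑ˡ k) ∈ₛ A Vec.++ B → i ∈ₛ A
∈-++ˡ⁻ {A = _ ∷ A} {i = F.zero} here = here
∈-++ˡ⁻ {A = _ ∷ A} {i = F.suc i} (there p) = there (∈-++ˡ⁻ p)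

∈-++ʳ⁺ : ∀ {m k} (A : Subset m) {B : Subset k} {i} → i ∈ₛ B → (m ↑ʳ i) ∈ₛ A Vec.++ B
∈-++ʳ⁺ [] p = p
∈-++ʳ⁺ (_ ∷ A) p = there (∈-++ʳ⁺ A p)

∈-++ʳ⁻ : ∀ {m k} (A : Subset m) {B : Subset k} {i} → (m ↑ʳ i) ∈ₛ A Vec.++ B → i ∈ₛ B
∈-++ʳ⁻ [] p = p
∈-++ʳ⁻ (_ ∷ A) (there p) = ∈-++ʳ⁻ A p

∣++∣ : ∀ {m k} (A : Subset m) (B : Subset k) → ∣ A Vec.++ B ∣ ≡ ∣ A ∣ + ∣ B ∣
∣++∣ [] B = refl
∣++∣ (true ∷ A) B = cong suc (∣++∣ A B)
∣++∣ (false ∷ A) B = ∣++∣ A B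

extend : ∀ {m} → Bool → Bool → Subset m × Subset m → Subset (suc m) × Subset (suc m)
extend a b (A , B) = a ∷ A , b ∷ B

extend-injective : ∀ {m a b} {p q : Subset m × Subset m} → extend a b p ≡ extend a b q → p ≡ q
extend-injective refl = refl

-- Such a pair is an independent set of the matching: the edges met in their left ends and those met
-- in their right ends. The recursion is Pascal's rule with a factor 2 for the choice of end.
disjointPairs : ∀ m → ℕ → List (Subset m × Subset m)
disjointPairs zero zero = [ [] , [] ]
disjointPairs zero (suc t) = []
disjointPairs (suc m) zero = map (extend false false) (disjointPairs m zero)
disjointPairs (suc m) (suc t) = map (extend false false) (disjointPairs m (suc t))
  ++ map (extend true false) (disjointPairs m t) ++ map (extend false true) (disjointPairs m t)

nC0≡1 : ∀ n → n C 0 ≡ 1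
nC0≡1 n = trans (nCk≡nC[n∸k] {0} {n} z≤n) (nCn≡1 n)

length-disjointPairs : ∀ m t → length (disjointPairs m t) ≡ 2 ^ t * (m C t)
length-disjointPairs zero zero = refl
length-disjointPairs zero (suc t) = sym (trans (cong (2 ^ suc t *_) (k>n⇒nCk≡0 {0} {suc t} (s≤s z≤n))) (*-zeroʳ (2 ^ suc t)))
length-disjointPairs (suc m) zero = begin
  length (map (extend false false) (disjointPairs m zero)) ≡⟨ length-map _ (disjointPairs m zero) ⟩
  length (disjointPairs m zero) ≡⟨ length-disjointPairs m zero ⟩
  1 * (m C 0) ≡⟨ cong (1 *_) (trans (nC0≡1 m) (sym (nC0≡1 (suc m)))) ⟩
  1 * (suc m C 0) ∎
  where open ≡-Reasoning
length-disjointPairs (suc m) (suc t) = begin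
  length (X ++ Y ++ Z) ≡⟨ trans (length-++ X) (cong (length X +_) (length-++ Y)) ⟩
  length X + (length Y + length Z)
    ≡⟨ cong₂ _+_ (length-map _ (disjointPairs m (suc t))) (cong₂ _+_ (length-map _ (disjointPairs m t)) (length-map _ (disjointPairs m t))) ⟩
  length (disjointPairs m (suc t)) + (length (disjointPairs m t) + length (disjointPairs m t))
    ≡⟨ cong₂ (λ x y → x + (y + y)) (length-disjointPairs m (suc t)) (length-disjointPairs m t) ⟩
  2 ^ suc t * (m C suc t) + (2 ^ t * (m C t) + 2 ^ t * (m C t)) ≡⟨ lemma (2 ^ t) (m C suc t) (m C t) ⟩
  2 ^ suc t * (m C t + m C suc t) ≡⟨ cong (2 ^ suc t *_) (nCk+nC[k+1]≡[n+1]C[k+1] m t) ⟩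
  2 ^ suc t * (suc m C suc t) ∎
  where
  open ≡-Reasoning
  X Y Z : List (Subset (suc m) × Subset (suc m))
  X = map (extend false false) (disjointPairs m (suc t))
  Y = map (extend true false) (disjointPairs m t)
  Z = map (extend false true) (disjointPairs m t)
  lemma : ∀ x y z → (2 * x) * y + (x * z + x * z) ≡ (2 * x) * (z + y)
  lemma = solve-∀

disjointPairs-unique : ∀ m t → Unique (disjointPairs m t)
disjointPairs-unique zero zero = [] ∷ []
disjointPairs-unique zero (suc t) = []
disjointPairs-unique (suc m) zero = Uniq.map⁺ extend-injective (disjointPairs-unique m zero)
disjointPairs-unique (suc m) (suc t) = Uniq.++⁺ (Uniq.map⁺ extend-injective (disjointPairs-unique m (suc t)))
  (Uniq.++⁺ (Uniq.map⁺ extend-injective (disjointPairs-unique m t)) (Uniq.map⁺ extend-injective (disjointPairs-unique m t)) disj₂) disj₁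
  where
  X = disjointPairs m (suc t)
  Y = disjointPairs m t
  disj₂ : ∀ {v} → v ∈ map (extend true false) Y × v ∈ map (extend false true) Y → Data.Empty.⊥
  disj₂ (i , j) with ∈-map⁻ (extend true false) i | ∈-map⁻ (extend false true) j
  ... | _ , _ , refl | _ , _ , ()
  disj₁ : ∀ {v} → v ∈ map (extend false false) X × v ∈ (map (extend true false) Y ++ map (extend false true) Y) → Data.Empty.⊥
  disj₁ (i , j) with ∈-map⁻ (extend false false) i | ∈-++⁻ (map (extend true false) Y) j
  ... | _ , _ , refl | inj₁ k with ∈-map⁻ (extend true false) k
  ...   | _ , _ , ()
  disj₁ (i , j) | _ , _ , refl | inj₂ k with ∈-map⁻ (extend false true) k
  ...   | _ , _ , ()

Disjoint : ∀ {m} → Subset m × Subset m → Set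
Disjoint (A , B) = ∀ i → i ∈ₛ A → i ∉ₛ B

disjoint-extend : ∀ {m} {p : Subset m × Subset m} a b → Disjoint p → ¬ (a ≡ true × b ≡ true) → Disjoint (extend a b p)
disjoint-extend a b dis ¬ab F.zero here here = ¬ab (refl , refl)
disjoint-extend a b dis ¬ab (F.suc i) (there p) (there q) = dis i p q

∈-disjointPairs⁻ : ∀ {m t p} → p ∈ disjointPairs m t → Disjoint p × ∣ proj₁ p ∣ + ∣ proj₂ p ∣ ≡ t
∈-disjointPairs⁻ {zero} {zero} (here refl) = (λ i ()) , refl
∈-disjointPairs⁻ {suc m} {zero} i with ∈-map⁻ (extend false false) i
... | p , i , refl = let dis , e = ∈-disjointPairs⁻ i in disjoint-extend false false dis (λ ()) , e
∈-disjointPairs⁻ {suc m} {suc t} i with ∈-++⁻ (map (extend false false) (disjointPairs m (suc t))) i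
... | inj₁ j with ∈-map⁻ (extend false false) j
...   | p , k , refl = let dis , e = ∈-disjointPairs⁻ k in disjoint-extend false false dis (λ ()) , e
∈-disjointPairs⁻ {suc m} {suc t} i | inj₂ j with ∈-++⁻ (map (extend true false) (disjointPairs m t)) j
... | inj₁ k with ∈-map⁻ (extend true false) k
...   | p , l , refl = let dis , e = ∈-disjointPairs⁻ l in disjoint-extend true false dis (λ ()) , cong suc e
∈-disjointPairs⁻ {suc m} {suc t} i | inj₂ j | inj₂ k with ∈-map⁻ (extend false true) k
...   | p , l , refl = let dis , e = ∈-disjointPairs⁻ l in disjoint-extend false true dis (λ ()) , trans (+-suc _ _) (cong suc e)

∈-disjointPairs⁺ : ∀ {m t} (A B : Subset m) → Disjoint (A , B) → ∣ A ∣ + ∣ B ∣ ≡ t → (A , B) ∈ disjointPairs m t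
∈-disjointPairs⁺ {t = zero} [] [] dis e = here refl
∈-disjointPairs⁺ {t = suc t} [] [] dis ()
∈-disjointPairs⁺ (true ∷ A) (true ∷ B) dis e = contradiction here (dis F.zero here)
∈-disjointPairs⁺ {suc m} {suc t} (true ∷ A) (false ∷ B) dis e =
  ∈-++⁺ʳ (map (extend false false) (disjointPairs m (suc t))) (∈-++⁺ˡ (∈-map⁺ (extend true false)
    (∈-disjointPairs⁺ A B (λ i p q → dis (F.suc i) (there p) (there q)) (cong pred e))))
∈-disjointPairs⁺ {t = zero} (false ∷ A) (true ∷ B) dis e = contradiction (trans (sym (+-suc ∣ A ∣ ∣ B ∣)) e) λ ()
∈-disjointPairs⁺ {suc m} {suc t} (false ∷ A) (true ∷ B) dis e =
  ∈-++⁺ʳ (map (extend false false) (disjointPairs m (suc t))) (∈-++⁺ʳ (map (extend true false) (disjointPairs m t)) (∈-map⁺ (extend false true)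
    (∈-disjointPairs⁺ A B (λ i p q → dis (F.suc i) (there p) (there q)) (cong pred (trans (sym (+-suc ∣ A ∣ ∣ B ∣)) e)))))
∈-disjointPairs⁺ {t = zero} (false ∷ A) (false ∷ B) dis e =
  ∈-map⁺ (extend false false) (∈-disjointPairs⁺ A B (λ i p q → dis (F.suc i) (there p) (there q)) e)
∈-disjointPairs⁺ {t = suc t} (false ∷ A) (false ∷ B) dis e = ∈-++⁺ˡ
  (∈-map⁺ (extend false false) (∈-disjointPairs⁺ A B (λ i p q → dis (F.suc i) (there p) (there q)) e))

∁-injective : ∀ {m} {A B : Subset m} → ∁ A ≡ ∁ B → A ≡ B
∁-injective {A = A} {B} e = trans (sym (∁-involutive A)) (trans (cong ∁ e) (∁-involutive B))

-- The matching graph and its cyclic arrangements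

module Matching (n : ℕ) where

  V : Set
  V = Fin (n + n)

  pt : V → V
  pt v with splitAt n v
  ... | inj₁ i = n ↑ʳ i
  ... | inj₂ i = i ↑ˡ n

  edge : V → Fin n
  edge v with splitAt n v
  ... | inj₁ i = i
  ... | inj₂ i = i

  data View : V → Set where
    left : ∀ i → View (i ↑ˡ n)
    right : ∀ i → View (n ↑ʳ i)

  view : ∀ v → View v
  view v with splitAt n v in e
  ... | inj₁ i = subst View (splitAt⁻¹-↑ˡ e) (left i)
  ... | inj₂ i = subst View (splitAt⁻¹-↑ʳ e) (right i)

  pt-left : ∀ i → pt (i ↑ˡ n) ≡ n ↑ʳ i
  pt-left i rewrite splitAt-↑ˡ n i n = refl

  pt-right : ∀ i → pt (n ↑ʳ i) ≡ i ↑ˡ n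
  pt-right i rewrite splitAt-↑ʳ n n i = refl

  edge-left : ∀ i → edge (i ↑ˡ n) ≡ i
  edge-left i rewrite splitAt-↑ˡ n i n = refl

  edge-right : ∀ i → edge (n ↑ʳ i) ≡ i
  edge-right i rewrite splitAt-↑ʳ n n i = refl

  left≢right : ∀ {i j} → i ↑ˡ n ≢ n ↑ʳ j
  left≢right {i} {j} e with trans (sym (splitAt-↑ˡ n i n)) (trans (cong (splitAt n) e) (splitAt-↑ʳ n n j))
  ... | ()

  pt-pt : ∀ v → pt (pt v) ≡ v
  pt-pt v with view v
  ... | left i = trans (cong pt (pt-left i)) (pt-right i)
  ... | right i = trans (cong pt (pt-right i)) (pt-left i)

  pt≢ : ∀ v → pt v ≢ v
  pt≢ v e with view v
  ... | left i = left≢right (trans (sym e) (pt-left i))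
  ... | right i = left≢right (trans (sym (pt-right i)) e)

  pt-injective : ∀ {u v} → pt u ≡ pt v → u ≡ v
  pt-injective {u} {v} e = trans (sym (pt-pt u)) (trans (cong pt e) (pt-pt v))

  edge-pt : ∀ v → edge (pt v) ≡ edge v
  edge-pt v with view v
  ... | left i = trans (cong edge (pt-left i)) (trans (edge-right i) (sym (edge-left i)))
  ... | right i = trans (cong edge (pt-right i)) (trans (edge-left i) (sym (edge-right i)))

  edge-≡ : ∀ u v → edge u ≡ edge v → u ≡ v ⊎ u ≡ pt v
  edge-≡ u v e with view u | view v
  ... | left i | left j = inj₁ (cong (_↑ˡ n) (trans (sym (edge-left i)) (trans e (edge-left j))))
  ... | left i | right j = inj₂ (trans (cong (_↑ˡ n) (trans (sym (edge-left i)) (trans e (edge-right j)))) (sym (pt-right j)))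
  ... | right i | left j = inj₂ (trans (cong (n ↑ʳ_) (trans (sym (edge-right i)) (trans e (edge-left j)))) (sym (pt-left j)))
  ... | right i | right j = inj₁ (cong (n ↑ʳ_) (trans (sym (edge-right i)) (trans e (edge-right j))))

  Ind : Subset (n + n) → Set
  Ind A = ∀ v → v ∈ₛ A → pt v ∉ₛ A

  Independent⇒Ind : ∀ {A} → Independent n A → Ind A
  Independent⇒Ind ind v v∈ p∈ with view v
  ... | left i = ind _ _ v∈ p∈ (i , inj₁ (refl , pt-left i))
  ... | right i = ind _ _ v∈ p∈ (i , inj₂ (refl , pt-right i))

  Ind⇒Independent : ∀ {A} → Ind A → Independent n A
  Ind⇒Independent {A} ind u v u∈ v∈ (i , inj₁ (refl , refl)) = ind u u∈ (subst (_∈ₛ A) (sym (pt-left i)) v∈)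
  Ind⇒Independent {A} ind u v u∈ v∈ (i , inj₂ (refl , refl)) = ind u u∈ (subst (_∈ₛ A) (sym (pt-right i)) v∈)

  ind-edges-unique : ∀ {A} → Ind A → Unique (map edge (elems A))
  ind-edges-unique {A} ind = map-unique-on edge (λ {u} {v} u∈ v∈ e → case u∈ v∈ (edge-≡ u v e)) (elems-unique A)
    where
    case : ∀ {u v} → u ∈ elems A → v ∈ elems A → u ≡ v ⊎ u ≡ pt v → u ≡ v
    case u∈ v∈ (inj₁ e) = e
    case u∈ v∈ (inj₂ refl) = contradiction (∈-elems⁻ u∈) (ind _ (∈-elems⁻ v∈))

  length-edges : ∀ A → length (map edge (elems A)) ≡ ∣ A ∣
  length-edges A = trans (length-map edge (elems A)) (length-elems A)

  ind-∣∣≤n : ∀ {A} → Ind A → ∣ A ∣ ≤ n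
  ind-∣∣≤n {A} ind = subst₂ _≤_ (length-edges A) (length-tabulate id)
    (unique-⊆⇒length≤ (ind-edges-unique ind) (λ _ → ∈-allFin _))

  ind-full : ∀ {A} → Ind A → n ≤ ∣ A ∣ → ∀ v → v ∈ₛ A ⊎ pt v ∈ₛ A
  ind-full {A} ind le v with ∈-map⁻ edge (unique-full (ind-edges-unique ind) (subst (n ≤_) (sym (length-edges A)) le) (edge v))
  ... | u , u∈ , e with edge-≡ v u e
  ...   | inj₁ refl = inj₁ (∈-elems⁻ u∈)
  ...   | inj₂ refl = inj₂ (subst (_∈ₛ A) (sym (pt-pt u)) (∈-elems⁻ u∈))

  module _ (A : Subset (n + n)) where

    -- The chosen end lies in `A` whenever the edge meets `A`. So the transversal is contained in
    -- `A` as soon as `∁ A` is independent, and for any `A` it shows that maximum independent sets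
    -- have `n` elements.
    pick : Fin n → V
    pick i with (i ↑ˡ n) ∈ₛ? A
    ... | yes _ = i ↑ˡ n
    ... | no _ = n ↑ʳ i

    edge-pick : ∀ i → edge (pick i) ≡ i
    edge-pick i with (i ↑ˡ n) ∈ₛ? A
    ... | yes _ = edge-left i
    ... | no _ = edge-right i

    picks : List V
    picks = map pick (allFin n)

    picks-edges : map edge picks ≡ allFin n
    picks-edges = trans (sym (map-∘ (allFin n))) (trans (map-cong edge-pick (allFin n)) (map-id (allFin n)))

    transversal : Subset (n + n)
    transversal = setOf picks

    transversal-ind : Ind transversal
    transversal-ind v v∈ p∈ = contradiction
      (unique-map-inj edge (subst Unique (sym picks-edges) (Uniq.allFin⁺ n)) (∈-setOf⁻ p∈) (∈-setOf⁻ v∈) (edge-pt v))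
      (pt≢ v)

    transversal-∣∣ : ∣ transversal ∣ ≡ n
    transversal-∣∣ = trans
      (sym (length-unique≡∣∣ (Uniq.map⁻ {f = edge} (subst Unique (sym picks-edges) (Uniq.allFin⁺ n))) ∈-setOf⁺ ∈-setOf⁻))
      (trans (length-map pick (allFin n)) (length-tabulate id))

    transversal-⊆ : Ind (∁ A) → transversal ⊆ₛ A
    transversal-⊆ ind v∈ with ∈-map⁻ pick (∈-setOf⁻ {xs = picks} v∈)
    ... | i , _ , refl with (i ↑ˡ n) ∈ₛ? A
    ...   | yes p = p
    ...   | no ¬p = x∉∁p⇒x∈p (subst (_∉ₛ ∁ A) (pt-left i) (ind _ (x∉p⇒x∈∁p ¬p)))

    transversal-max : MaximumIndependent n transversal
    transversal-max = Ind⇒Independent transversal-ind ,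
      λ J indJ → subst (∣ J ∣ ≤_) (sym transversal-∣∣) (ind-∣∣≤n (Independent⇒Ind indJ))

  max-∣∣ : ∀ {I} → MaximumIndependent n I → n ≤ ∣ I ∣
  max-∣∣ {I} (_ , max) = subst (_≤ ∣ I ∣) (transversal-∣∣ I) (max _ (proj₁ (transversal-max I)))

  -- A set contains a maximum independent set exactly if it meets every edge, that is, if its
  -- complement is independent. For `r ≤ n` this adds nothing to the independent sets, and for
  -- `r > n` no independent sets exist.
  Shape : ℕ → Subset (n + n) → Set
  Shape r A = (r ≤ n × Ind A) ⊎ (n < r × Ind (∁ A))

  ℋ⇒Shape : ∀ {r A} → ℋ n r A → ∣ A ∣ ≡ r × Shape r A
  ℋ⇒Shape (inj₁ (ind , e)) = e , inj₁ (subst (_≤ n) e (ind-∣∣≤n (Independent⇒Ind ind)) , Independent⇒Ind ind)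
  ℋ⇒Shape {r} {A} (inj₂ (e , I , maxI , I⊆A)) with r ≤? n
  ... | yes r≤n = e , inj₁ (r≤n , subst Ind (⊆∧∣∣≥⇒≡ I⊆A (≤-trans (≤-reflexive e) (≤-trans r≤n (max-∣∣ maxI)))) (Independent⇒Ind (proj₁ maxI)))
  ... | no r≰n = e , inj₂ (≰⇒> r≰n , λ v v∈ p∈ → hit v (x∈∁p⇒x∉p v∈) (x∈∁p⇒x∉p p∈))
    where
    hit : ∀ v → v ∉ₛ A → pt v ∉ₛ A → Data.Empty.⊥
    hit v v∉ p∉ with ind-full (Independent⇒Ind (proj₁ maxI)) (max-∣∣ maxI) v
    ... | inj₁ i = v∉ (I⊆A i)
    ... | inj₂ i = p∉ (I⊆A i)

  Shape⇒ℋ : ∀ {r A} → ∣ A ∣ ≡ r → Shape r A → ℋ n r A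
  Shape⇒ℋ e (inj₁ (_ , ind)) = inj₁ (Ind⇒Independent ind , e)
  Shape⇒ℋ {A = A} e (inj₂ (_ , ind)) = inj₂ (e , transversal A , transversal-max A , transversal-⊆ A ind)

  indSets : ℕ → List (Subset (n + n))
  indSets t = map (uncurry Vec._++_) (disjointPairs n t)

  length-indSets : ∀ t → length (indSets t) ≡ 2 ^ t * (n C t)
  length-indSets t = trans (length-map _ (disjointPairs n t)) (length-disjointPairs n t)

  indSets-unique : ∀ t → Unique (indSets t)
  indSets-unique t = Uniq.map⁺ (λ {p} {q} e → let e₁ , e₂ = Vecₚ.++-injective (proj₁ p) (proj₁ q) e in cong₂ _,_ e₁ e₂)
    (disjointPairs-unique n t)

  ∈-indSets⁺ : ∀ {A t} → Ind A → ∣ A ∣ ≡ t → A ∈ indSets t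
  ∈-indSets⁺ {A} ind e with Vec.splitAt n A
  ... | A , B , refl = ∈-map⁺ (uncurry Vec._++_) (∈-disjointPairs⁺ A B
    (λ i i∈A i∈B → ind (i ↑ˡ n) (∈-++ˡ⁺ i∈A) (subst (_∈ₛ A Vec.++ B) (sym (pt-left i)) (∈-++ʳ⁺ A i∈B)))
    (trans (sym (∣++∣ A B)) e))

  ∈-indSets⁻ : ∀ {A t} → A ∈ indSets t → Ind A × ∣ A ∣ ≡ t
  ∈-indSets⁻ {t = t} i with ∈-map⁻ (uncurry Vec._++_) {xs = disjointPairs n t} i
  ... | (A , B) , j , refl = let dis , e = ∈-disjointPairs⁻ j in ind dis , trans (∣++∣ A B) e
    where
    ind : Disjoint (A , B) → Ind (A Vec.++ B)
    ind dis v v∈ p∈ with view v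
    ... | left i = dis i (∈-++ˡ⁻ v∈) (∈-++ʳ⁻ A (subst (_∈ₛ A Vec.++ B) (pt-left i) p∈))
    ... | right i = dis i (∈-++ˡ⁻ (subst (_∈ₛ A Vec.++ B) (pt-right i) p∈)) (∈-++ʳ⁻ A v∈)

  module _ (r : ℕ) (r≤N : r ≤ n + n) where

    abstract
      sets : List (Subset (n + n))
      sets with r ≤? n
      ... | yes _ = indSets r
      ... | no _ = map ∁ (indSets (n + n ∸ r))

      length-sets-small : r ≤ n → length sets ≡ 2 ^ r * (n C r)
      length-sets-small r≤n with r ≤? n
      ... | yes _ = length-indSets r
      ... | no r≰n = contradiction r≤n r≰n

      length-sets-large : n < r → length sets ≡ 2 ^ (n + n ∸ r) * (n C (n + n ∸ r))
      length-sets-large n<r with r ≤? n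
      ... | yes r≤n = contradiction r≤n (<⇒≱ n<r)
      ... | no _ = trans (length-map ∁ (indSets (n + n ∸ r))) (length-indSets (n + n ∸ r))

      sets-unique : Unique sets
      sets-unique with r ≤? n
      ... | yes _ = indSets-unique r
      ... | no _ = Uniq.map⁺ ∁-injective (indSets-unique (n + n ∸ r))

      ∈-sets⁺ : ∀ {A} → ∣ A ∣ ≡ r → Shape r A → A ∈ sets
      ∈-sets⁺ {A} e sh with r ≤? n | sh
      ... | yes _ | inj₁ (_ , ind) = ∈-indSets⁺ ind e
      ... | yes r≤n | inj₂ (n<r , _) = contradiction r≤n (<⇒≱ n<r)
      ... | no r≰n | inj₁ (r≤n , _) = contradiction r≤n r≰n
      ... | no _ | inj₂ (_ , ind) = subst (_∈ map ∁ (indSets (n + n ∸ r))) (∁-involutive A)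
        (∈-map⁺ ∁ (∈-indSets⁺ ind (trans (∣∁p∣≡n∸∣p∣ A) (cong (n + n ∸_) e))))

      ∈-sets⁻ : ∀ {A} → A ∈ sets → ∣ A ∣ ≡ r × Shape r A
      ∈-sets⁻ {A} i with r ≤? n
      ... | yes r≤n = let ind , e = ∈-indSets⁻ i in e , inj₁ (r≤n , ind)
      ... | no r≰n with ∈-map⁻ ∁ i
      ...   | B , j , refl = let ind , e = ∈-indSets⁻ {t = n + n ∸ r} j in
        trans (∣∁p∣≡n∸∣p∣ B) (trans (cong (n + n ∸_) e) (m∸[m∸n]≡n r≤N)) ,
        inj₂ (≰⇒> r≰n , subst Ind (sym (∁-involutive B)) ind)

  -- Cyclic arrangements encoded by words

  module Words (d : Fin (n + n)) (0<n : 0 < n) where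

    N : ℕ
    N = n + n

    -- A word lists one end of each edge; read cyclically, with the partners in the
    -- second half of the cycle, it orders all 2n vertices with partners antipodal.
    Good : List V → Set
    Good w = length w ≡ n × Unique (map edge w)

    -- The head returns at the far end as its partner; so `n` rotations of a good word yield the
    -- partners and `2n` the word itself, and `n` letters encode the whole cycle.
    rot : List V → List V
    rot [] = []
    rot (x ∷ w) = w ++ [ pt x ]

    rots : ℕ → List V → List V
    rots zero w = w
    rots (suc j) w = rots j (rot w)

    -- The default `d` never occurs for good words, whose length is `n > 0`.
    hd : List V → V
    hd [] = d
    hd (x ∷ w) = x

    seq : List V → ℕ → V
    seq w j = hd (rots j w)

    rots-+ : ∀ i j w → rots (i + j) w ≡ rots j (rots i w)
    rots-+ zero j w = refl
    rots-+ (suc i) j w = rots-+ i j (rot w)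

    seq-+ : ∀ i j w → seq w (i + j) ≡ seq (rots i w) j
    seq-+ i j w = cong hd (rots-+ i j w)

    rots-++ : ∀ xs ys → rots (length xs) (xs ++ ys) ≡ ys ++ map pt xs
    rots-++ [] ys = sym (++-identityʳ ys)
    rots-++ (x ∷ xs) ys = begin
      rots (length xs) ((xs ++ ys) ++ [ pt x ]) ≡⟨ cong (rots (length xs)) (++-assoc xs ys _) ⟩
      rots (length xs) (xs ++ (ys ++ [ pt x ])) ≡⟨ rots-++ xs _ ⟩
      (ys ++ [ pt x ]) ++ map pt xs             ≡⟨ ++-assoc ys _ _ ⟩
      ys ++ pt x ∷ map pt xs                    ∎
      where open ≡-Reasoning

    rots-length : ∀ w → rots (length w) w ≡ map pt w
    rots-length w = trans (cong (rots (length w)) (sym (++-identityʳ w))) (rots-++ w [])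

    rots-map : ∀ (g : V → V) → (∀ v → g (pt v) ≡ pt (g v)) → ∀ j w → rots j (map g w) ≡ map g (rots j w)
    rots-map g g-pt zero w = refl
    rots-map g g-pt (suc j) [] = rots-map g g-pt j []
    rots-map g g-pt (suc j) (x ∷ w) = trans
      (cong (rots j) (trans (cong (λ y → map g w ++ [ y ]) (sym (g-pt x))) (sym (map-++ g w [ pt x ]))))
      (rots-map g g-pt j (w ++ [ pt x ]))

    map-pt-pt : ∀ w → map pt (map pt w) ≡ w
    map-pt-pt w = trans (sym (map-∘ w)) (trans (map-cong pt-pt w) (map-id w))

    length-rot : ∀ w → length (rot w) ≡ length w
    length-rot [] = refl
    length-rot (x ∷ w) = trans (length-++ w) (+-comm (length w) 1)

    length-rots : ∀ j w → length (rots j w) ≡ length w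
    length-rots zero w = refl
    length-rots (suc j) w = trans (length-rots j (rot w)) (length-rot w)

    rot-edges-unique : ∀ {w} → Unique (map edge w) → Unique (map edge (rot w))
    rot-edges-unique {[]} u = u
    rot-edges-unique {x ∷ w} u = Unique-resp-↭ (↭-trans (↭-reflexive (cong (_∷ map edge w) (sym (edge-pt x))))
      (Perm.map⁺ edge (Perm.∷↭∷ʳ (pt x) w))) u

    good-rot : ∀ {w} → Good w → Good (rot w)
    good-rot {w} (l , u) = trans (length-rot w) l , rot-edges-unique {w} u

    good-rots : ∀ j {w} → Good w → Good (rots j w)
    good-rots zero g = g
    good-rots (suc j) g = good-rots j (good-rot g)

    good-↭ : ∀ {w w′} → w ↭ w′ → Good w → Good w′
    good-↭ p (l , u) = trans (sym (Perm.↭-length p)) l , Unique-resp-↭ (Perm.map⁺ edge p) u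

    rots-n : ∀ {w} → Good w → rots n w ≡ map pt w
    rots-n {w} (l , _) = subst (λ m → rots m w ≡ map pt w) l (rots-length w)

    rots-N+ : ∀ {w} → Good w → ∀ j → rots (N + j) w ≡ rots j w
    rots-N+ {w} g j = begin
      rots (n + n + j) w       ≡⟨ rots-+ (n + n) j w ⟩
      rots j (rots (n + n) w)  ≡⟨ cong (rots j) (rots-+ n n w) ⟩
      rots j (rots n (rots n w)) ≡⟨ cong (rots j) (rots-n (good-rots n g)) ⟩
      rots j (map pt (rots n w)) ≡⟨ cong (rots j ∘ map pt) (rots-n g) ⟩
      rots j (map pt (map pt w)) ≡⟨ cong (rots j) (map-pt-pt w) ⟩
      rots j w ∎
      where open ≡-Reasoning

    seq-N+ : ∀ {w} → Good w → ∀ j → seq w (N + j) ≡ seq w j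
    seq-N+ g j = cong hd (rots-N+ g j)

    seq-prefix : ∀ xs {ys zs q} → q < length xs → seq (xs ++ ys) q ≡ seq (xs ++ zs) q
    seq-prefix (x ∷ xs) {q = zero} _ = refl
    seq-prefix (x ∷ xs) {ys} {zs} {suc q} (s≤s q<) = trans (cong (λ w → seq w q) (++-assoc xs ys _))
      (trans (seq-prefix xs q<) (cong (λ w → seq w q) (sym (++-assoc xs zs _))))

    seq-length : ∀ xs y ys → seq (xs ++ y ∷ ys) (length xs) ≡ y
    seq-length xs y ys = cong hd (rots-++ xs (y ∷ ys))

    mutual
      seq-∈ : ∀ w {q} → q < length w → seq w q ∈ w
      seq-∈ (x ∷ w) {zero} _ = here refl
      seq-∈ (x ∷ w) {suc q} (s≤s q<) = there (seq-suc-∈ x w q<)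

      seq-suc-∈ : ∀ x w {q} → q < length w → seq (x ∷ w) (suc q) ∈ w
      seq-suc-∈ x w {q} q< = subst (_∈ w)
        (trans (cong (λ v → seq v q) (sym (++-identityʳ w))) (seq-prefix w q<)) (seq-∈ w q<)

    ∈⇒seq : ∀ {w y} → y ∈ w → ∃ λ q → q < length w × y ≡ seq w q
    ∈⇒seq {y = y} y∈ with ∈-∃++ y∈
    ... | as , bs , refl = length as , subst (length as <_) (sym (length-++ as)) (m<m+n _ (s≤s z≤n)) , sym (seq-length as y bs)

    map-seq : ∀ xs ys → map (seq (xs ++ ys)) (upTo (length xs)) ≡ xs
    map-seq xs ys = trans (map-upTo (seq (xs ++ ys)) (length xs)) (go xs ys)
      where
      applyUpTo-cong : ∀ {f g : ℕ → V} m → (∀ i → f i ≡ g i) → applyUpTo f m ≡ applyUpTo g m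
      applyUpTo-cong zero e = refl
      applyUpTo-cong (suc m) e = cong₂ _∷_ (e 0) (applyUpTo-cong m (e ∘ suc))
      go : ∀ xs ys → applyUpTo (seq (xs ++ ys)) (length xs) ≡ xs
      go [] ys = refl
      go (x ∷ xs) ys = cong (x ∷_) (trans (applyUpTo-cong (length xs) (λ i → cong (λ w → seq w i) (++-assoc xs ys _))) (go xs _))

    hd-map : ∀ (g : V → V) {w} → 0 < length w → hd (map g w) ≡ g (hd w)
    hd-map g {x ∷ w} _ = refl

    seq-map : ∀ (g : V → V) → (∀ v → g (pt v) ≡ pt (g v)) → ∀ {w} → Good w → ∀ j → seq (map g w) j ≡ g (seq w j)
    seq-map g g-pt {w} (l , _) j = trans (cong hd (rots-map g g-pt j w))
      (hd-map g {rots j w} (subst (0 <_) (sym (trans (length-rots j w) l)) 0<n))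

    seq-n+ : ∀ {w} → Good w → ∀ j → seq w (n + j) ≡ pt (seq w j)
    seq-n+ {w} g j = trans (seq-+ n j w) (trans (cong (λ v → seq v j) (rots-n g)) (seq-map pt (λ _ → refl) g j))

    private
      -- In the first half the edges differ, position `n` holds the partner of the first vertex, and
      -- the positions after it again lie on other edges.
      seq-0 : ∀ {w} → Good w → ∀ {e} → e < N → seq w 0 ≡ seq w e → e ≡ 0
      seq-0 g {zero} e<N eq = refl
      seq-0 {[]} (l , _) e<N eq = contradiction (subst (0 <_) (sym l) 0<n) λ ()
      seq-0 {x ∷ w} g@(l , (x∉ ∷ u)) {suc e} e<N eq with suc e <? n
      ... | yes e<n = contradiction (cong edge eq) (All.lookup x∉ (∈-map⁺ edge (seq-suc-∈ x w e<w)))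
        where
        e<w : e < length w
        e<w = ≤-pred (subst (suc (suc e) ≤_) (sym l) e<n)
      ... | no e≮n with m≤n⇒∃[o]m+o≡n (≮⇒≥ e≮n)
      ...   | zero , refl′ = contradiction (trans (sym (trans (cong (seq (x ∷ w)) (sym refl′)) (seq-n+ g 0))) (sym eq)) (pt≢ x)
      ...   | suc f , refl′ = contradiction
          (trans (cong edge eq) (trans (cong (edge ∘ seq (x ∷ w)) (sym refl′)) (trans (cong edge (seq-n+ g (suc f))) (edge-pt _))))
          (All.lookup x∉ (∈-map⁺ edge (seq-suc-∈ x w f<w)))
        where
        f<n : suc f < n
        f<n = +-cancelˡ-< n (suc f) n (subst (_< N) (sym refl′) e<N)
        f<w : f < length w
        f<w = ≤-pred (subst (suc (suc f) ≤_) (sym l) f<n)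

    seq-inj : ∀ {w} → Good w → ∀ {u v} → u ≤ v → v < u + N → seq w u ≡ seq w v → u ≡ v
    seq-inj {w} g {u} u≤v v<u+N eq with m≤n⇒∃[o]m+o≡n u≤v
    ... | e , refl = trans (sym (+-identityʳ u)) (cong (u +_) (sym (seq-0 (good-rots u g) (+-cancelˡ-< u e N v<u+N)
      (trans eq (seq-+ u e w)))))

    seq-inj-window : ∀ {w} → Good w → ∀ a {u v} → a ≤ u → u < a + N → a ≤ v → v < a + N → seq w u ≡ seq w v → u ≡ v
    seq-inj-window g a {u} {v} a≤u u< a≤v v< eq with ≤-total u v
    ... | inj₁ u≤v = seq-inj g u≤v (≤-trans v< (+-monoˡ-≤ N a≤u)) eq
    ... | inj₂ v≤u = sym (seq-inj g v≤u (≤-trans u< (+-monoˡ-≤ N a≤v)) (sym eq))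

    seq-surj : ∀ {w} → Good w → ∀ a v → ∃ λ p → a ≤ p × p < a + N × v ≡ seq w p
    seq-surj {w} g a v =
      let e , e<N , eq = from-0 (good-rots a g)
      in a + e , m≤m+n a e , +-monoʳ-< a e<N , trans eq (sym (seq-+ a e w))
      where
      from-0 : ∀ {w} → Good w → ∃ λ e → e < N × v ≡ seq w e
      from-0 {w} g@(l , u) with ∈-map⁻ edge (unique-full u (≤-reflexive (sym (trans (length-map edge w) l))) (edge v))
      ... | y , y∈ , eq with ∈⇒seq y∈
      ...   | q , q< , refl with edge-≡ v _ eq
      ...     | inj₁ e = q , ≤-trans (subst (q <_) l q<) (m≤m+n n n) , e
      ...     | inj₂ e = n + q , +-monoʳ-< n (subst (q <_) l q<) , trans e (sym (seq-n+ g q))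

    -- An arc of the cycle. Positions are not reduced modulo `N`; `I-N+` supplies the periodicity
    -- instead.
    I : List V → ℕ → ℕ → Subset (n + n)
    I w j r = setOf (map (λ i → seq w (j + i)) (upTo r))

    ∈-I⁺ : ∀ w j {r i} → i < r → seq w (j + i) ∈ₛ I w j r
    ∈-I⁺ w j i<r = ∈-setOf⁺ (∈-map⁺ _ (∈-upTo⁺ i<r))

    ∈-I⁻ : ∀ {w j r v} → v ∈ₛ I w j r → ∃ λ i → i < r × v ≡ seq w (j + i)
    ∈-I⁻ {w} {j} {r} v∈ with ∈-map⁻ (λ i → seq w (j + i)) (∈-setOf⁻ {xs = map (λ i → seq w (j + i)) (upTo r)} v∈)
    ... | i , i∈ , e = i , ∈-upTo⁻ i∈ , e

    ∈-I⁺′ : ∀ w {j r p} → j ≤ p → p < j + r → seq w p ∈ₛ I w j r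
    ∈-I⁺′ w {j} {r} j≤p p< with m≤n⇒∃[o]m+o≡n j≤p
    ... | i , refl = ∈-I⁺ w j (+-cancelˡ-< j i r p<)

    I-rots : ∀ w i j r → I (rots i w) j r ≡ I w (i + j) r
    I-rots w i j r = cong setOf (map-cong (λ q → trans (sym (seq-+ i (j + q) w)) (cong (seq w) (sym (+-assoc i j q)))) (upTo r))

    I-N+ : ∀ {w} → Good w → ∀ j r → I w (N + j) r ≡ I w j r
    I-N+ {w} g j r = trans (sym (I-rots w N j r)) (cong (λ v → I v j r)
      (trans (cong (λ m → rots m w) (sym (+-identityʳ N))) (rots-N+ g 0)))

    -- Positions are compared within one period starting at a.
    ∈-I-window : ∀ {w} → Good w → ∀ {a j r p} → a ≤ p → p < a + N → a ≤ j → j + r ≤ a + N →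
      seq w p ∈ₛ I w j r → j ≤ p × p < j + r
    ∈-I-window {w} g {a} {j} {r} a≤p p< a≤j j+r≤ p∈ with ∈-I⁻ {w} {j} {r} p∈
    ... | i , i<r , e with seq-inj-window g a a≤p p< (≤-trans a≤j (m≤m+n j i)) (≤-trans (+-monoʳ-< j i<r) j+r≤) e
    ...   | refl = m≤m+n j i , +-monoʳ-< j i<r

    I-∣∣ : ∀ {w} → Good w → ∀ j {r} → r ≤ N → ∣ I w j r ∣ ≡ r
    I-∣∣ {w} g j {r} r≤N = trans (sym (length-unique≡∣∣ uniq ∈-setOf⁺ ∈-setOf⁻))
      (trans (length-map _ (upTo r)) (length-upTo r))
      where
      uniq : Unique (map (λ i → seq w (j + i)) (upTo r))
      uniq = map-unique-on _ (λ {u} {v} u∈ v∈ e → +-cancelˡ-≡ j u v (seq-inj-window g j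
        (m≤m+n j u) (+-monoʳ-< j (≤-trans (∈-upTo⁻ u∈) r≤N)) (m≤m+n j v) (+-monoʳ-< j (≤-trans (∈-upTo⁻ v∈) r≤N)) e))
        (Uniq.upTo⁺ r)

    I-∁ : ∀ {w} → Good w → ∀ j {r} → r ≤ N → ∁ (I w j r) ≡ I w (j + r) (N ∸ r)
    I-∁ {w} g j {r} r≤N = ⊆-antisym to from
      where
      end : j + r + (N ∸ r) ≡ j + N
      end = trans (+-assoc j r _) (cong (j +_) (m+[n∸m]≡n r≤N))
      to : ∁ (I w j r) ⊆ₛ I w (j + r) (N ∸ r)
      to {v} v∉ with seq-surj g j v
      ... | p , j≤p , p< , refl with p <? j + r
      ...   | yes p<j+r = contradiction (∈-I⁺′ w j≤p p<j+r) (x∈∁p⇒x∉p v∉)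
      ...   | no p≮ = ∈-I⁺′ w (≮⇒≥ p≮) (subst (p <_) (sym end) p<)
      from : I w (j + r) (N ∸ r) ⊆ₛ ∁ (I w j r)
      from {v} v∈ with ∈-I⁻ {w} {j + r} {N ∸ r} v∈
      ... | i , i< , refl = x∉p⇒x∈∁p λ v∈′ →
        contradiction (proj₂ (∈-I-window g {a = j} (≤-trans (m≤m+n j r) (m≤m+n (j + r) i))
          (subst (j + r + i <_) end (+-monoʳ-< (j + r) i<)) ≤-refl (+-monoʳ-≤ j r≤N) v∈′))
          (≤⇒≯ (m≤m+n (j + r) i))

    -- The partner of a vertex sits `n` positions further on: beyond the end of the arc, yet within
    -- the period that begins with the arc.
    I-ind : ∀ {w} → Good w → ∀ j {r} → r ≤ n → Ind (I w j r)
    I-ind {w} g j {r} r≤n v v∈ p∈ with ∈-I⁻ {w} {j} {r} v∈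
    ... | i , i<r , refl = contradiction
      (proj₂ (∈-I-window g {a = j} {p = n + (j + i)} (≤-trans (m≤m+n j i) (m≤n+m (j + i) n))
        (≤-by (≤-trans i<r r≤n) (lemma₁ n j i)) ≤-refl (+-monoʳ-≤ j (≤-trans r≤n (m≤m+n n n)))
        (subst (_∈ₛ I w j r) (sym (seq-n+ g (j + i))) p∈)))
      (≤⇒≯ (≤-trans (+-monoʳ-≤ j r≤n) (≤-by (z≤n {i}) (lemma₂ n j i))))
      where
      lemma₁ : ∀ n j i → suc (n + (j + i)) + n ≡ j + (n + n) + suc i
      lemma₁ = solve-∀
      lemma₂ : ∀ n j i → j + n + i ≡ n + (j + i) + 0
      lemma₂ = solve-∀

    I-shape : ∀ {w} → Good w → ∀ j {r} → r ≤ N → Shape r (I w j r)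
    I-shape {w} g j {r} r≤N with r ≤? n
    ... | yes r≤n = inj₁ (r≤n , I-ind g j r≤n)
    ... | no r≰n = inj₂ (≰⇒> r≰n , subst Ind (sym (I-∁ g j r≤N)) (I-ind g (j + r)
      (≤-trans (∸-monoʳ-≤ N (≰⇒≥ r≰n)) (≤-reflexive (m+n∸n≡m n n)))))

    abstract
      -- Behind x come the vertices of A, then the edges missing A, then the vertices whose
      -- partners are in A; these partners end the cycle, just before x.
      independent-interval : ∀ {x xs A} → Good (x ∷ xs) → Ind A → x ∈ₛ A →
        ∃ λ ys → xs ↭ ys × ∃ λ j → A ≡ I (x ∷ ys) j ∣ A ∣
      independent-interval {x} {xs} {A} g ind x∈A =
        ys , perm , j , trans A≡I (cong (I w j) (sym ∣A∣))
        where
        P R Q M M′ ys w u L : List V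
        P = filter (_∈ₛ? A) xs
        R = filter (¬? ∘ (_∈ₛ? A)) xs
        Q = filter (λ v → pt v ∈ₛ? A) R
        M = filter (¬? ∘ (λ v → pt v ∈ₛ? A)) R
        M′ = (x ∷ P) ++ M
        ys = P ++ M ++ Q
        w = x ∷ ys
        u = Q ++ map pt M′
        L = map pt Q ++ x ∷ P
        -- Past `M′` the word continues with `Q`; a further half turn (`length u` is `n`) leads to
        -- the partners of `Q`, where the arc has to start.
        j : ℕ
        j = length M′ + length u
        perm : xs ↭ ys
        perm = ↭-trans (↭-sym (filter-¬-++-↭ (_∈ₛ? A) xs)) (Perm.++⁺ˡ P
          (↭-trans (↭-sym (filter-¬-++-↭ (λ v → pt v ∈ₛ? A) R)) (Perm.++-comm Q M)))
        w-good : Good w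
        w-good = good-↭ (prep x perm) g
        rots-j : rots j w ≡ L ++ M
        rots-j = begin
          rots j w                             ≡⟨ rots-+ (length M′) (length u) w ⟩
          rots (length u) (rots (length M′) w) ≡⟨ cong (λ v → rots (length u) (rots (length M′) v)) (sym (++-assoc (x ∷ P) M Q)) ⟩
          rots (length u) (rots (length M′) (M′ ++ Q)) ≡⟨ cong (rots (length u)) (rots-++ M′ Q) ⟩
          rots (length u) u                    ≡⟨ rots-length u ⟩
          map pt u                             ≡⟨ map-++ pt Q (map pt M′) ⟩
          map pt Q ++ map pt (map pt M′)       ≡⟨ cong (map pt Q ++_) (map-pt-pt M′) ⟩
          map pt Q ++ (x ∷ P) ++ M             ≡⟨ ++-assoc (map pt Q) (x ∷ P) M ⟨
          L ++ M                               ∎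
          where open ≡-Reasoning
        to : ∀ {v} → v ∈ₛ A → v ∈ L
        to {v} v∈ with ∈-map⁻ edge (unique-full (proj₂ g) (≤-reflexive (sym (trans (length-map edge (x ∷ xs)) (proj₁ g)))) (edge v))
        ... | y , y∈ , e with edge-≡ v y e
        to v∈ | _ , here refl , _ | inj₁ refl = ∈-++⁺ʳ (map pt Q) (here refl)
        to v∈ | _ , there y∈ , _ | inj₁ refl = ∈-++⁺ʳ (map pt Q) (there (∈-filter⁺ _ y∈ v∈))
        to v∈ | _ , here refl , _ | inj₂ refl = contradiction v∈ (ind _ x∈A)
        to v∈ | y , there y∈ , _ | inj₂ refl = ∈-++⁺ˡ (∈-map⁺ pt
          (∈-filter⁺ _ (∈-filter⁺ _ y∈ (λ y∈A → ind y y∈A v∈)) v∈))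
        from : ∀ {v} → v ∈ L → v ∈ₛ A
        from v∈ with ∈-++⁻ (map pt Q) v∈
        ... | inj₁ i with ∈-map⁻ pt i
        ...   | y , y∈ , refl = proj₂ (∈-filter⁻ (λ v → pt v ∈ₛ? A) {xs = R} y∈)
        from v∈ | inj₂ (here refl) = x∈A
        from v∈ | inj₂ (there i) = proj₂ (∈-filter⁻ (_∈ₛ? A) {xs = xs} i)
        A≡I : A ≡ I w j (length L)
        A≡I = begin
          A                           ≡⟨ ⊆-antisym (∈-setOf⁺ ∘ to) (from ∘ ∈-setOf⁻) ⟩
          setOf L                     ≡⟨ cong setOf (map-seq L M) ⟨
          I (L ++ M) 0 (length L)     ≡⟨ cong (λ v → I v 0 (length L)) rots-j ⟨
          I (rots j w) 0 (length L)   ≡⟨ I-rots w j 0 (length L) ⟩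
          I w (j + 0) (length L)      ≡⟨ cong (λ i → I w i (length L)) (+-identityʳ j) ⟩
          I w j (length L)            ∎
          where open ≡-Reasoning
        L≤N : length L ≤ N
        L≤N = ≤-trans (≤-trans (subst (length L ≤_) (sym (length-++ L)) (m≤m+n _ _))
          (≤-reflexive (trans (cong length (sym rots-j)) (proj₁ (good-rots j w-good))))) (m≤m+n n n)
        ∣A∣ : ∣ A ∣ ≡ length L
        ∣A∣ = trans (cong ∣_∣ A≡I) (I-∣∣ w-good j L≤N)

    -- Swapping two adjacent letters of a word

    seq-skip : ∀ ps qs {q} → q < length qs → seq (ps ++ qs) (length ps + q) ≡ seq qs q
    seq-skip ps qs {q} q< = trans (seq-+ (length ps) q (ps ++ qs))
      (trans (cong (λ v → seq v q) (rots-++ ps qs))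
        (trans (seq-prefix qs q<) (cong (λ v → seq v q) (++-identityʳ qs))))

    -- The index is a position in the swapped word `w′`; `up` and `down` say that its vertex stood
    -- one position later or earlier in `w`. The partners at `n + l` and `n + l + 1` are exchanged
    -- along with the letters at `l` and `l + 1`.
    data Moved (w w′ : List V) (l : ℕ) : ℕ → Set where
      fixed : ∀ {p} → seq w′ p ≡ seq w p → Moved w w′ l p
      up    : ∀ {p} → p ≡ l ⊎ p ≡ n + l → seq w′ p ≡ seq w (suc p) → Moved w w′ l p
      down  : ∀ {p} → p ≡ l ⊎ p ≡ n + l → seq w′ (suc p) ≡ seq w p → Moved w w′ l (suc p)

    swap-moved-first : ∀ ps a b qs → let w = ps ++ a ∷ b ∷ qs ; w′ = ps ++ b ∷ a ∷ qs in
      ∀ p → p < length w → Moved w w′ (length ps) p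
    swap-moved-first ps a b qs p p< = by-cases (<-cmp p (length ps))
      where
      w = ps ++ a ∷ b ∷ qs
      w′ = ps ++ b ∷ a ∷ qs
      seq-second : ∀ a b → seq (ps ++ a ∷ b ∷ qs) (suc (length ps)) ≡ b
      seq-second a b = trans (cong₂ seq (sym (++-assoc ps [ a ] (b ∷ qs)))
        (sym (trans (length-++ ps) (+-comm (length ps) 1)))) (seq-length (ps ++ [ a ]) b qs)
      seq-rest : ∀ a b q → q < length qs → seq (ps ++ a ∷ b ∷ qs) (suc (suc (length ps)) + q) ≡ seq qs q
      seq-rest a b q q< = trans (cong₂ seq (sym (++-assoc ps (a ∷ b ∷ []) qs))
        (cong (_+ q) (sym (trans (length-++ ps) (+-comm (length ps) 2))))) (seq-skip (ps ++ a ∷ b ∷ []) qs q<)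
      by-cases : Tri (p < length ps) (p ≡ length ps) (length ps < p) → Moved w w′ (length ps) p
      by-cases (tri< p<l _ _) = fixed (seq-prefix ps p<l)
      by-cases (tri≈ _ p≡l _) = up (inj₁ p≡l) (subst (λ p → seq w′ p ≡ seq w (suc p)) (sym p≡l)
        (trans (seq-length ps b (a ∷ qs)) (sym (seq-second a b))))
      by-cases (tri> _ _ p>l) with m≤n⇒∃[o]m+o≡n p>l
      ... | zero , e = subst (Moved w w′ _) (trans (sym (+-identityʳ _)) e)
              (down (inj₁ refl) (trans (seq-second b a) (sym (seq-length ps a (b ∷ qs)))))
      ... | suc q , e = fixed (trans (cong (seq w′) eq) (trans (seq-rest b a q q<) (sym (trans (cong (seq w) eq) (seq-rest a b q q<)))))
        where
        eq : p ≡ suc (suc (length ps)) + q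
        eq = trans (sym e) (+-suc (suc (length ps)) q)
        q< : q < length qs
        q< = +-cancelˡ-< (2 + length ps) q (length qs) (≤-trans (≤-reflexive (cong suc (sym eq)))
          (≤-trans p< (≤-reflexive (trans (length-++ ps) (trans (+-suc _ _) (cong suc (+-suc _ _)))))))

    swap-moved : ∀ ps a b qs → let w = ps ++ a ∷ b ∷ qs ; w′ = ps ++ b ∷ a ∷ qs in
      Good w → ∀ p → p < N → Moved w w′ (length ps) p
    swap-moved ps a b qs g p p<N with p <? n
    ... | yes p<n = swap-moved-first ps a b qs p (subst (p <_) (sym (proj₁ g)) p<n)
    ... | no p≮n with m≤n⇒∃[o]m+o≡n (≮⇒≥ p≮n)
    ...   | q , refl = second (swap-moved-first ps a b qs q (subst (q <_) (sym (proj₁ g)) q<n)) q<n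
      where
      w = ps ++ a ∷ b ∷ qs
      w′ = ps ++ b ∷ a ∷ qs
      q<n : q < n
      q<n = +-cancelˡ-< n q n p<N
      g′ : Good w′
      g′ = good-↭ (Perm.++⁺ˡ ps (swap a b refl)) g
      second : ∀ {q} → Moved w w′ (length ps) q → q < n → Moved w w′ (length ps) (n + q)
      second (fixed e) _ = fixed (trans (seq-n+ g′ _) (trans (cong pt e) (sym (seq-n+ g _))))
      second {q} (up (inj₁ refl) e) _ = up (inj₂ refl) (trans (seq-n+ g′ q) (trans (cong pt e)
        (trans (sym (seq-n+ g (suc q))) (cong (seq w) (+-suc n q)))))
      second (up (inj₂ refl) e) q<n = contradiction q<n (≤⇒≯ (m≤m+n n _))
      second {suc q} (down (inj₁ refl) e) _ = subst (Moved w w′ _) (sym (+-suc n q)) (down (inj₂ refl)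
        (trans (cong (seq w′) (sym (+-suc n q))) (trans (seq-n+ g′ (suc q)) (trans (cong pt e) (sym (seq-n+ g q))))))
      second (down (inj₂ refl) e) q<n = contradiction q<n (≤⇒≯ (≤-trans (m≤m+n n _) (n≤1+n _)))

    -- A good word read as an automorphism of the matching: the two ends of an edge are numbered `i`
    -- and `n + i`, so vertices double as positions and partners as antipodes.
    position : List V → V → V
    position w v = seq w (toℕ v)

    position-pt : ∀ {w} → Good w → ∀ v → position w (pt v) ≡ pt (position w v)
    position-pt {w} g v with view v
    ... | left i = trans (cong (position w) (pt-left i)) (trans (cong (seq w) (Finₚ.toℕ-↑ʳ n i))
          (trans (seq-n+ g (toℕ i)) (cong (pt ∘ seq w) (sym (Finₚ.toℕ-↑ˡ i n)))))
    ... | right i = trans (cong (position w) (pt-right i)) (trans (cong (seq w) (Finₚ.toℕ-↑ˡ i n))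
          (trans (sym (pt-pt _)) (cong pt (trans (sym (seq-n+ g (toℕ i))) (cong (seq w) (sym (Finₚ.toℕ-↑ʳ n i)))))))

    position-injective : ∀ {w} → Good w → ∀ {u v} → position w u ≡ position w v → u ≡ v
    position-injective g {u} {v} e = toℕ-injective (seq-inj-window g 0 z≤n (toℕ<n u) z≤n (toℕ<n v) e)

    comp : List V → List V → List V
    comp w = map (position w)

    good-comp : ∀ {w u} → Good w → Good u → Good (comp w u)
    good-comp {w} {u} g (l , uniq) = trans (length-map _ u) l ,
      subst Unique (map-∘ u) (map-unique-on (edge ∘ position w) inj (Uniq.map⁻ {f = edge} uniq))
      where
      inj : ∀ {a b} → a ∈ u → b ∈ u → edge (position w a) ≡ edge (position w b) → a ≡ b
      inj {a} {b} a∈ b∈ e with edge-≡ _ _ e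
      ... | inj₁ e′ = position-injective g e′
      ... | inj₂ e′ = unique-map-inj edge uniq a∈ b∈
        (trans (cong edge (position-injective g (trans e′ (sym (position-pt g b))))) (edge-pt b))

    -- Enumerating the words and counting those with a given initial arc

    lists : ℕ → List (List V)
    lists zero = [ [] ]
    lists (suc m) = cartesianProductWith _∷_ (allFin (n + n)) (lists m)

    lists-unique : ∀ m → Unique (lists m)
    lists-unique zero = [] ∷ []
    lists-unique (suc m) = Uniq.cartesianProductWith⁺ _∷_ ∷-injective (Uniq.allFin⁺ (n + n)) (lists-unique m)

    ∈-lists : ∀ w → w ∈ lists (length w)
    ∈-lists [] = here refl
    ∈-lists (x ∷ w) = ∈-cartesianProductWith⁺ _∷_ (∈-allFin x) (∈-lists w)

    good? : Decidable Good
    good? w = (length w ≟ n) ×-dec UniqDec.unique? Finₚ._≟_ (map edge w)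

    abstract
      words : List (List V)
      words = filter good? (lists n)

      words-unique : Unique words
      words-unique = Uniq.filter⁺ good? (lists-unique n)

      ∈-words⁺ : ∀ {w} → Good w → w ∈ words
      ∈-words⁺ {w} g = ∈-filter⁺ good? (subst (λ m → w ∈ lists m) (proj₁ g) (∈-lists w)) g

      ∈-words⁻ : ∀ {w} → w ∈ words → Good w
      ∈-words⁻ i = proj₂ (∈-filter⁻ good? {xs = lists n} i)

    -- An injective map of a finite set into itself permutes it.
    ∑-words-reindex : ∀ (φ : List V → List V) → (∀ {w} → Good w → Good (φ w)) → (∀ {w w′} → φ w ≡ φ w′ → w ≡ w′) →
      ∀ f → ∑ words (f ∘ φ) ≡ ∑ words f
    ∑-words-reindex φ φ-good φ-inj f = trans (sym (∑-map φ words f)) (∑-↭ f (↭-sym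
      (unique-⊆-length≥⇒↭ (Uniq.map⁺ φ-inj words-unique) sub (≤-reflexive (sym (length-map φ words))))))
      where
      sub : ∀ {w} → w ∈ map φ words → w ∈ words
      sub i with ∈-map⁻ φ i
      ... | w , w∈ , refl = ∈-words⁺ (φ-good (∈-words⁻ w∈))

    rot-injective : ∀ {w w′} → rot w ≡ rot w′ → w ≡ w′
    rot-injective {[]} {[]} e = refl
    rot-injective {[]} {x ∷ w} e = contradiction (trans (cong length e) (length-rot (x ∷ w))) λ ()
    rot-injective {x ∷ w} {[]} e = contradiction (trans (sym (cong length e)) (length-rot (x ∷ w))) λ ()
    rot-injective {x ∷ w} {y ∷ w′} e with ∷ʳ-injective w w′ e
    ... | e₁ , e₂ = cong₂ _∷_ (pt-injective e₂) e₁

    ∑-words-rots : ∀ j f → ∑ words (f ∘ rots j) ≡ ∑ words f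
    ∑-words-rots zero f = refl
    ∑-words-rots (suc j) f = trans (∑-words-reindex rot good-rot rot-injective (f ∘ rots j)) (∑-words-rots j f)

    abstract
      _≟ₛ_ : (A B : Subset (n + n)) → Dec (A ≡ B)
      _≟ₛ_ = Vecₚ.≡-dec Boolₚ._≟_

    -- Words act on themselves through comp, so the number of words starting with a
    -- given set does not depend on the set.
    module _ (r : ℕ) (r≤N : r ≤ N) where

      I₀ : Subset (n + n)
      I₀ = setOf (filter (λ v → toℕ v <? r) (allFin (n + n)))

      ∈-I₀⁺ : ∀ {v} → toℕ v < r → v ∈ₛ I₀
      ∈-I₀⁺ v<r = ∈-setOf⁺ (∈-filter⁺ _ (∈-allFin _) v<r)

      ∈-I₀⁻ : ∀ {v} → v ∈ₛ I₀ → toℕ v < r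
      ∈-I₀⁻ v∈ = proj₂ (∈-filter⁻ (λ v → toℕ v <? r) {xs = allFin (n + n)} (∈-setOf⁻ v∈))

      -- The order of the stabiliser of `I₀` in the automorphism group; the words with a given
      -- initial arc form a coset of this stabiliser.
      multiplicity : ℕ
      multiplicity = ∑ words (λ u → δ (I₀ ≟ₛ I u 0 r))

      module _ {w : List V} (g : Good w) where

        seq-comp : ∀ {u} → Good u → ∀ j → seq (comp w u) j ≡ position w (seq u j)
        seq-comp gu j = seq-map (position w) (position-pt g) gu j

        seq-position : ∀ {i} → i < r → ∃ λ v → toℕ v < r × seq w i ≡ position w v
        seq-position {i} i<r = fromℕ< i<N , subst (_< r) (sym (toℕ-fromℕ< i<N)) i<r , cong (seq w) (sym (toℕ-fromℕ< i<N))
          where i<N = ≤-trans i<r r≤N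

        position-I : ∀ {v} → position w v ∈ₛ I w 0 r → toℕ v < r
        position-I {v} v∈ = proj₂ (∈-I-window g {a = 0} z≤n (toℕ<n v) ≤-refl r≤N v∈)

        comp-I⁺ : ∀ {u} → Good u → I₀ ≡ I u 0 r → I w 0 r ≡ I (comp w u) 0 r
        comp-I⁺ {u} gu e = ⊆-antisym to from
          where
          to : I w 0 r ⊆ₛ I (comp w u) 0 r
          to v∈ with ∈-I⁻ {w} {0} {r} v∈
          ... | i , i<r , refl with seq-position i<r
          ...   | v , v<r , eq with ∈-I⁻ {u} {0} {r} (subst (v ∈ₛ_) e (∈-I₀⁺ v<r))
          ...     | i′ , i′<r , refl = subst (_∈ₛ I (comp w u) 0 r) (trans (seq-comp gu i′) (sym eq)) (∈-I⁺ (comp w u) 0 i′<r)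
          from : I (comp w u) 0 r ⊆ₛ I w 0 r
          from v∈ with ∈-I⁻ {comp w u} {0} {r} v∈
          ... | i , i<r , refl = subst (_∈ₛ I w 0 r) (sym (seq-comp gu i))
            (∈-I⁺ w 0 (∈-I₀⁻ (subst (seq u i ∈ₛ_) (sym e) (∈-I⁺ u 0 i<r))))

        comp-I⁻ : ∀ {u} → Good u → I w 0 r ≡ I (comp w u) 0 r → I₀ ≡ I u 0 r
        comp-I⁻ {u} gu e = ⊆-antisym to from
          where
          to : I₀ ⊆ₛ I u 0 r
          to {v} v∈ with ∈-I⁻ {comp w u} {0} {r} (subst (position w v ∈ₛ_) e (∈-I⁺ w 0 (∈-I₀⁻ v∈)))
          ... | i , i<r , eq = subst (_∈ₛ I u 0 r) (sym (position-injective g (trans eq (seq-comp gu i)))) (∈-I⁺ u 0 i<r)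
          from : I u 0 r ⊆ₛ I₀
          from v∈ with ∈-I⁻ {u} {0} {r} v∈
          ... | i , i<r , refl = ∈-I₀⁺ (position-I (subst (_∈ₛ I w 0 r) (seq-comp gu i)
            (subst (seq (comp w u) i ∈ₛ_) (sym e) (∈-I⁺ (comp w u) 0 i<r))))

        multiplicity-I : ∑ words (λ u → δ (I w 0 r ≟ₛ I u 0 r)) ≡ multiplicity
        multiplicity-I = begin
          ∑ words (λ u → δ (I w 0 r ≟ₛ I u 0 r))
            ≡⟨ ∑-words-reindex (comp w) (good-comp g) (Listₚ.map-injective (position-injective g)) (λ u → δ (I w 0 r ≟ₛ I u 0 r)) ⟨
          ∑ words (λ u → δ (I w 0 r ≟ₛ I (comp w u) 0 r))
            ≡⟨ ∑-cong words (λ u∈ → δ-⇔ (I w 0 r ≟ₛ _) (I₀ ≟ₛ _) (comp-I⁻ (∈-words⁻ u∈)) (comp-I⁺ (∈-words⁻ u∈))) ⟩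
          multiplicity ∎
          where open ≡-Reasoning

        multiplicity>0 : 0 < multiplicity
        multiplicity>0 = subst (0 <_) multiplicity-I (≤-trans (≤-reflexive (sym (δ-yes (I w 0 r ≟ₛ I w 0 r) refl)))
          (∈⇒≤∑ (λ u → δ (I w 0 r ≟ₛ I u 0 r)) (∈-words⁺ g)))

    _∈?_ : ∀ (A : Subset (n + n)) F → Dec (A ∈ F)
    _∈?_ = DecMem._∈?_ _≟ₛ_

    -- Averaging over all words

    module Averaging (r : ℕ) (0<r : 0 < r) (r<N : r < n + n) where

      r≤N : r ≤ N
      r≤N = <⇒≤ r<N

      ℋs : List (Subset (n + n))
      ℋs = sets r r≤N

      abstract
        -- In the second case the reordering is made for `∁ A`; the set `A` is then the arc that
        -- begins where its complement ends.
        interval : ∀ {x xs A} → Good (x ∷ xs) → ∣ A ∣ ≡ r → (Ind A × x ∈ₛ A) ⊎ (Ind (∁ A) × x ∉ₛ A) →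
          ∃ λ ys → xs ↭ ys × ∃ λ j → A ≡ I (x ∷ ys) j r
        interval g refl (inj₁ (ind , x∈)) = independent-interval g ind x∈
        interval {x} {xs} {A} g e (inj₂ (ind , x∉)) =
          let ys , p , j , eq = independent-interval g ind (x∉p⇒x∈∁p x∉)
          in ys , p , j + (N ∸ r) , shifted ys p j eq
          where
          open ≡-Reasoning
          shifted : ∀ ys → xs ↭ ys → ∀ j → ∁ A ≡ I (x ∷ ys) j ∣ ∁ A ∣ → A ≡ I (x ∷ ys) (j + (N ∸ r)) r
          shifted ys p j eq = begin
            A ≡⟨ ∁-involutive A ⟨
            ∁ (∁ A) ≡⟨ cong ∁ eq ⟩
            ∁ (I (x ∷ ys) j ∣ ∁ A ∣) ≡⟨ cong (λ t → ∁ (I (x ∷ ys) j t)) (trans (∣∁p∣≡n∸∣p∣ A) (cong (N ∸_) e)) ⟩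
            ∁ (I (x ∷ ys) j (N ∸ r)) ≡⟨ I-∁ (good-↭ (prep x p) g) j (m∸n≤m N r) ⟩
            I (x ∷ ys) (j + (N ∸ r)) (N ∸ (N ∸ r)) ≡⟨ cong (I (x ∷ ys) (j + (N ∸ r))) (m∸[m∸n]≡n r≤N) ⟩
            I (x ∷ ys) (j + (N ∸ r)) r ∎

        some-word : List V
        some-word = picks ⊥

        some-good : Good some-word
        some-good = trans (length-map (pick ⊥) (allFin n)) (length-tabulate id) ,
          subst Unique (sym (picks-edges ⊥)) (Uniq.allFin⁺ n)

        word-from : ∀ x → ∃ λ xs → Good (x ∷ xs)
        word-from x with seq-surj some-good 0 x
        ... | p , _ , _ , e with rots p some-word | good-rots p some-good | e
        ...   | [] | l , _ | _ = contradiction (subst (0 <_) (sym l) 0<n) λ ()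
        ...   | y ∷ ys | g | refl = ys , g

        nonempty : ∀ {A : Subset (n + n)} → 0 < ∣ A ∣ → ∃ λ x → x ∈ₛ A
        nonempty {A} pos with elems A in eq
        ... | [] = contradiction (subst (0 <_) (trans (sym (length-elems A)) (cong length eq)) pos) λ ()
        ... | x ∷ _ = x , ∈-elems⁻ (subst (x ∈_) (sym eq) (here refl))

        pointed : ∀ {A} → ∣ A ∣ ≡ r → Shape r A → ∃ λ x → (Ind A × x ∈ₛ A) ⊎ (Ind (∁ A) × x ∉ₛ A)
        pointed e (inj₁ (_ , ind)) = let x , x∈ = nonempty (subst (0 <_) (sym e) 0<r) in x , inj₁ (ind , x∈)
        pointed {A} e (inj₂ (_ , ind)) =
          let x , x∈ = nonempty {∁ A} (subst (0 <_) (sym (trans (∣∁p∣≡n∸∣p∣ A) (cong (N ∸_) e))) (m<n⇒0<n∸m r<N))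
          in x , inj₂ (ind , x∈∁p⇒x∉p x∈)

        -- As `0 < r < N`, the independent one of `A` and `∁ A` has a vertex; a word beginning there
        -- is reordered to make `A` an arc, then rotated to the start of it.
        initial : ∀ {A} → ∣ A ∣ ≡ r → Shape r A → ∃ λ w → Good w × A ≡ I w 0 r
        initial {A} e sh =
          let x , p = pointed {A} e sh
              xs , g = word-from x
              ys , perm , j , eq = interval g e p
          in rots j (x ∷ ys) , good-rots j (good-↭ (prep x perm) g) ,
          trans eq (trans (cong (λ i → I (x ∷ ys) i r) (sym (+-identityʳ j))) (sym (I-rots (x ∷ ys) j 0 r)))

      μ : ℕ
      μ = multiplicity r r≤N

      instance
        μ≢0 : NonZero μ
        μ≢0 = >-nonZero (multiplicity>0 r r≤N some-good)

      ∑-initial : ∀ F → Unique F → (∀ {A} → A ∈ F → ∣ A ∣ ≡ r × Shape r A) →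
        ∑ words (λ u → δ (I u 0 r ∈? F)) ≡ length F * μ
      ∑-initial F uniq sh = begin
        ∑ words (λ u → δ (I u 0 r ∈? F))
          ≡⟨ ∑-cong words (λ {u} _ → ∑δ-unique _≟ₛ_ uniq (I u 0 r ∈? F)) ⟨
        ∑ words (λ u → ∑ F (λ A → δ (I u 0 r ≟ₛ A)))
          ≡⟨ ∑-swap words F _ ⟩
        ∑ F (λ A → ∑ words (λ u → δ (I u 0 r ≟ₛ A)))
          ≡⟨ ∑-cong F (λ A∈ → const-μ (sh A∈)) ⟩
        ∑ F (λ _ → μ)
          ≡⟨ ∑-const F μ ⟩
        length F * μ ∎
        where
        open ≡-Reasoning
        const-μ : ∀ {A} → ∣ A ∣ ≡ r × Shape r A → ∑ words (λ u → δ (I u 0 r ≟ₛ A)) ≡ μ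
        const-μ {A} (e , s) =
          let w , g , A≡I = initial e s in
          trans (∑-cong words λ {u} _ → δ-⇔ (I u 0 r ≟ₛ A) (I w 0 r ≟ₛ I u 0 r)
              (λ p → trans (sym A≡I) (sym p)) (λ p → trans (sym p) (sym A≡I)))
            (multiplicity-I r r≤N g)

      -- The count of `∑-initial` with all of ℋʳ as the family, to which every initial arc belongs.
      length-words : length words ≡ length ℋs * μ
      length-words = begin
        length words ≡⟨ *-identityʳ _ ⟨
        length words * 1 ≡⟨ ∑-const words 1 ⟨
        ∑ words (λ _ → 1) ≡⟨ ∑-cong words (λ {u} u∈ → δ-yes (I u 0 r ∈? ℋs)
          (∈-sets⁺ r r≤N (I-∣∣ (∈-words⁻ u∈) 0 r≤N) (I-shape (∈-words⁻ u∈) 0 r≤N))) ⟨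
        ∑ words (λ u → δ (I u 0 r ∈? ℋs)) ≡⟨ ∑-initial ℋs (sets-unique r r≤N) (∈-sets⁻ r r≤N) ⟩
        length ℋs * μ ∎
        where open ≡-Reasoning

      module Family (F : List (Subset (n + n))) (F-unique : Unique F)
        (F-shape : ∀ {A} → A ∈ F → ∣ A ∣ ≡ r × Shape r A) where

        -- Arcs are indexed by the start `b` of the complementary arc, as the predicate `Q` of the
        -- cycle argument requires.
        arcs : List V → ℕ
        arcs u = ∑ (upTo N) (λ b → δ (I u (b + (N ∸ r)) r ∈? F))

        ∑-arcs : ∑ words arcs ≡ N * (length F * μ)
        ∑-arcs = begin
          ∑ words arcs ≡⟨ ∑-swap words (upTo N) _ ⟩
          ∑ (upTo N) (λ b → ∑ words (λ u → δ (I u (b + (N ∸ r)) r ∈? F))) ≡⟨ ∑-cong (upTo N) (λ {b} _ → each (b + (N ∸ r))) ⟩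
          ∑ (upTo N) (λ _ → length F * μ) ≡⟨ ∑-const (upTo N) _ ⟩
          length (upTo N) * (length F * μ) ≡⟨ cong (_* (length F * μ)) (length-upTo N) ⟩
          N * (length F * μ) ∎
          where
          open ≡-Reasoning
          each : ∀ j → ∑ words (λ u → δ (I u j r ∈? F)) ≡ length F * μ
          each j = trans (∑-cong words λ {u} _ → cong (λ A → δ (A ∈? F))
              (trans (cong (λ i → I u i r) (sym (+-identityʳ j))) (sym (I-rots u j 0 r))))
            (trans (∑-words-rots j (λ u → δ (I u 0 r ∈? F))) (∑-initial F F-unique F-shape))

        private
          lhs : N * (length F * μ) ≡ N * length F * μ
          lhs = sym (*-assoc N (length F) μ)

          rhs : length words * r ≡ r * length ℋs * μ
          rhs = trans (*-comm (length words) r) (trans (cong (r *_) length-words) (sym (*-assoc r (length ℋs) μ)))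

        average-≤ : (∀ {u} → Good u → arcs u ≤ r) → N * length F ≤ r * length ℋs
        average-≤ le = *-cancelʳ-≤ (N * length F) (r * length ℋs) μ
          (subst₂ _≤_ (trans ∑-arcs lhs) rhs (∑-≤ words (λ u∈ → le (∈-words⁻ u∈))))

        average-tight : (∀ {u} → Good u → arcs u ≤ r) → r * length ℋs ≤ N * length F → ∀ {u} → Good u → r ≤ arcs u
        average-tight le ge g = ∑-≤-tight words (λ u∈ → le (∈-words⁻ u∈))
          (subst₂ _≤_ (sym rhs) (sym (trans ∑-arcs lhs)) (*-monoˡ-≤ μ ge)) (∈-words⁺ g)

        average-≡ : (∀ {u} → Good u → arcs u ≡ r) → N * length F ≡ r * length ℋs
        average-≡ e = *-cancelʳ-≡ (N * length F) (r * length ℋs) μ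
          (trans (sym (trans ∑-arcs lhs)) (trans (trans (∑-cong words (λ u∈ → e (∈-words⁻ u∈))) (∑-const words r)) rhs))

      s : ℕ
      s = N ∸ r

      r+s≡N : r + s ≡ N
      r+s≡N = m+[n∸m]≡n r≤N

      0<s : 0 < s
      0<s = m<n⇒0<n∸m r<N

      s<N : s < N
      s<N = subst (s <_) r+s≡N (m<n+m s 0<r)

      -- Found from the last index downwards: if `p` lies before `b (suc m)`, the step condition
      -- puts it before the end of the arc at `b m`.
      chain : ∀ (b : ℕ → ℕ) → (∀ i → b (suc i) ≤ b i + s) → ∀ m {p} → b 0 ≤ p → p < b m + s →
        ∃ λ i → i ≤ m × b i ≤ p × p < b i + s
      chain b step zero b≤p p< = 0 , z≤n , b≤p , p<
      chain b step (suc m) {p} b≤p p< with b (suc m) ≤? p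
      ... | yes le = suc m , ≤-refl , le , p<
      ... | no b≰p = let i , i≤m , rest = chain b step m b≤p (≤-trans (≰⇒> b≰p) (step m))
                     in i , m≤n⇒m≤1+n i≤m , rest

      ∉-opposite-arc : ∀ {w} → Good w → ∀ {b p} → b ≤ p → p < b + s → seq w p ∉ₛ I w (b + s) r
      ∉-opposite-arc {w} g {b} {p} b≤p p< p∈ = contradiction
        (proj₁ (∈-I-window g {a = b} b≤p (≤-trans p< (+-monoʳ-≤ b (<⇒≤ s<N))) (m≤m+n b s)
          (≤-reflexive (trans (+-assoc b s r) (cong (b +_) (trans (+-comm s r) r+s≡N)))) p∈))
        (<⇒≱ p<)

      I-periodic : ∀ {w} → Good w → ∀ b → I w (N + b + s) r ≡ I w (b + s) r
      I-periodic {w} g b = trans (cong (λ j → I w j r) (+-assoc N b s)) (I-N+ g (b + s) r)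

      rots-mod : ∀ {w} → Good w → ∀ q z → rots (q * N + z) w ≡ rots z w
      rots-mod g zero z = refl
      rots-mod {w} g (suc q) z = trans (cong (λ j → rots j w) (+-assoc N (q * N) z)) (trans (rots-N+ g (q * N + z)) (rots-mod g q z))

      instance
        N≢0 : NonZero N
        N≢0 = >-nonZero (≤-trans 0<s (m∸n≤m N r))

      rots-% : ∀ {w} → Good w → ∀ z → rots z w ≡ rots (z % N) w
      rots-% {w} g z = trans (cong (λ j → rots j w) (trans (m≡m%n+[m/n]*n z N) (+-comm (z % N) _))) (rots-mod g (z / N) (z % N))

      normal-start : ∀ {w} → Good w → ∀ j → ∃ λ j′ → 1 ≤ j′ × j′ ≤ N × I w j r ≡ I w j′ r
      normal-start {w} g j = by-cases (j % N) refl
        where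
        I-% : I w j r ≡ I w (j % N) r
        I-% = begin
          I w j r              ≡⟨ cong (λ i → I w i r) (+-identityʳ j) ⟨
          I w (j + 0) r        ≡⟨ I-rots w j 0 r ⟨
          I (rots j w) 0 r     ≡⟨ cong (λ v → I v 0 r) (rots-% g j) ⟩
          I (rots (j % N) w) 0 r ≡⟨ I-rots w (j % N) 0 r ⟩
          I w (j % N + 0) r    ≡⟨ cong (λ i → I w i r) (+-identityʳ (j % N)) ⟩
          I w (j % N) r        ∎
          where open ≡-Reasoning
        by-cases : ∀ j₀ → j % N ≡ j₀ → ∃ λ j′ → 1 ≤ j′ × j′ ≤ N × I w j r ≡ I w j′ r
        by-cases zero e = N , ≤-trans 0<s (m∸n≤m N r) , ≤-refl ,
          trans I-% (trans (cong (λ i → I w i r) e) (trans (sym (I-N+ g 0 r)) (cong (λ i → I w i r) (+-identityʳ N))))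
        by-cases (suc j₀) e = suc j₀ , s≤s z≤n , subst (_≤ N) e (m%n≤n j N) , trans I-% (cong (λ i → I w i r) e)

      -- Position 0 is read as position `N`, which lies in the period starting at `j`; the arc
      -- reaches it exactly if `N < j + r`, that is, `s < j`.
      ∈-arc⇒ : ∀ {w} → Good w → ∀ {j} → 1 ≤ j → j ≤ N → seq w 0 ∈ₛ I w j r → s < j
      ∈-arc⇒ {w} g {j} 1≤j j≤N 0∈ = +-cancelˡ-< r s j (subst₂ _<_ (sym r+s≡N) (+-comm j r)
        (proj₂ (∈-I-window g {a = j} j≤N (m<n+m N 1≤j) ≤-refl (+-monoʳ-≤ j r≤N)
          (subst (_∈ₛ I w j r) (trans (sym (seq-N+ g 0)) (cong (seq w) (+-identityʳ N))) 0∈))))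

      ∈-arc⇐ : ∀ {w} → Good w → ∀ {j} → j ≤ N → s < j → seq w 0 ∈ₛ I w j r
      ∈-arc⇐ {w} g {j} j≤N s<j = subst (_∈ₛ I w j r) (trans (cong (seq w) (sym (+-identityʳ N))) (seq-N+ g 0))
        (∈-I⁺′ w j≤N (subst₂ _<_ r+s≡N (+-comm r j) (+-monoʳ-< r s<j)))

      -- Stars

      module Stars (F : List (Subset (n + n))) where

        -- The members of F among the arcs of w are those through the first vertex of w.
        Star : List V → Set
        Star w = ∀ j → 1 ≤ j → j ≤ N → (s < j → I w j r ∈ F) × (I w j r ∈ F → s < j)

        star-∈ : ∀ {w} → Good w → Star w → ∀ j → (seq w 0 ∈ₛ I w j r → I w j r ∈ F) × (I w j r ∈ F → seq w 0 ∈ₛ I w j r)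
        star-∈ {w} g star j =
          let j′ , 1≤j′ , j′≤N , e = normal-start g j
              to , from = star j′ 1≤j′ j′≤N
          in (λ 0∈ → subst (_∈ F) (sym e) (to (∈-arc⇒ g 1≤j′ j′≤N (subst (seq w 0 ∈ₛ_) e 0∈)))) ,
             (λ I∈ → subst (seq w 0 ∈ₛ_) (sym e) (∈-arc⇐ g j′≤N (from (subst (_∈ F) e I∈))))

      -- In every arrangement exactly `r` arcs pass through `x`, so averaging is exact. This gives
      -- one direction of the equality statement and, in the other, equal sizes of family and star.
      star-size : ∀ {G x} → Unique G → (∀ {A} → A ∈ G → ∣ A ∣ ≡ r × Shape r A) → (∀ {A} → A ∈ G → x ∈ₛ A) →
        (∀ {A} → ∣ A ∣ ≡ r → Shape r A → x ∈ₛ A → A ∈ G) → N * length G ≡ r * length ℋs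
      star-size {G} {x} G-unique G-shape x∈G G-full = Family.average-≡ G G-unique G-shape each
        where
        each : ∀ {u} → Good u → Family.arcs G G-unique G-shape u ≡ r
        each {u} g =
          let p , _ , p<N , x≡ = seq-surj g 0 x in begin
          -- With this shift, and `x` rotated to the front, term `b` concerns the arc starting at
          -- `suc b`, which contains `x` exactly for `b ≥ s`.
          ∑ (upTo N) f ≡⟨ ∑-upTo-periodic N f (λ b → cong (λ A → δ (A ∈? G)) (I-periodic g b)) (suc p + r) ⟨
          ∑ (upTo N) (λ b → f (suc p + r + b)) ≡⟨ ∑-cong (upTo N) (λ {b} b∈ → at p x≡ b (∈-upTo⁻ b∈)) ⟩
          ∑ (upTo N) (λ b → δ (s ≤? b)) ≡⟨ cong (λ m → ∑ (upTo m) (λ b → δ (s ≤? b))) (trans (sym r+s≡N) (+-comm r s)) ⟩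
          ∑ (upTo (s + r)) (λ b → δ (s ≤? b)) ≡⟨ ∑-upTo-≥ s r ⟩
          r ∎
          where
          open ≡-Reasoning
          f : ℕ → ℕ
          f b = δ (I u (b + s) r ∈? G)
          at : ∀ p → x ≡ seq u p → ∀ b → b < N → f (suc p + r + b) ≡ δ (s ≤? b)
          at p x≡ b b<N = trans (cong (λ A → δ (A ∈? G)) arc≡) (δ-⇔ (I v (suc b) r ∈? G) (s ≤? b)
              (λ I∈ → ≤-pred (∈-arc⇒ gv (s≤s z≤n) b<N (subst (_∈ₛ I v (suc b) r) x≡′ (x∈G I∈))))
              (λ s≤b → G-full (I-∣∣ gv (suc b) r≤N) (I-shape gv (suc b) r≤N)
                (subst (_∈ₛ I v (suc b) r) (sym x≡′) (∈-arc⇐ gv b<N (s≤s s≤b)))))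
            where
            v : List V
            v = rots p u
            gv : Good v
            gv = good-rots p g
            x≡′ : x ≡ seq v 0
            x≡′ = trans x≡ (trans (cong (seq u) (sym (+-identityʳ p))) (seq-+ p 0 u))
            arc≡ : I u (suc p + r + b + s) r ≡ I v (suc b) r
            arc≡ = trans (cong (λ j → I u j r) (trans (lemma p r b s) (cong (_+ (p + suc b)) r+s≡N)))
              (trans (I-N+ g (p + suc b) r) (sym (I-rots u p (suc b) r)))
              where
              lemma : ∀ p r b s → suc p + r + b + s ≡ (r + s) + (p + suc b)
              lemma = solve-∀

      -- k-wise intersecting families

      module Intersecting (k″ : ℕ) (F : List (Subset (n + n))) (F-unique : Unique F)
        (F-shape : ∀ {A} → A ∈ F → ∣ A ∣ ≡ r × Shape r A)
        (F-kwise : KWiseIntersecting (suc (suc k″)) F) (N≤ks : N ≤ suc (suc k″) * s) where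

        open Stars F

        k′ : ℕ
        k′ = suc k″

        arcs : List V → ℕ
        arcs = Family.arcs F F-unique F-shape

        Q : List V → ℕ → Set
        Q w b = I w (b + s) r ∈ F

        Q? : ∀ w → Decidable (Q w)
        Q? w b = I w (b + s) r ∈? F

        module _ {w : List V} (g : Good w) where

          Q-periodic : ∀ b → Q w b → Q w (N + b)
          Q-periodic b = subst (_∈ F) (sym (I-periodic g b))

          Q-periodic⁻ : ∀ b → Q w (N + b) → Q w b
          Q-periodic⁻ b = subst (_∈ F) (I-periodic g b)

          -- A common vertex of the k members would lie in one of the complementary arcs if these
          -- went round.
          nocover : ∀ (b : ℕ → ℕ) → (∀ i → i ≤ k′ → Q w (b i)) → (∀ i → b (suc i) ≤ b i + s) → b k′ + s < b 0 + N
          nocover b Qb step = ≰⇒> λ covers →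
            let x , x∈ = F-kwise (λ i → I w (b (toℕ i) + s) r) (λ i → Qb (toℕ i) (≤-pred (toℕ<n i)))
                p , b≤p , p<b+N , x≡ = seq-surj g (b 0) x
                i , i≤k′ , bi≤p , p<bi = chain b step k′ b≤p (≤-trans p<b+N covers)
                toℕ-i = toℕ-fromℕ< (s≤s i≤k′)
            in ∉-opposite-arc g bi≤p p<bi (subst₂ (λ v j → v ∈ₛ I w (b j + s) r) x≡ toℕ-i (x∈ (fromℕ< (s≤s i≤k′))))

          arcs≤r : arcs w ≤ r
          arcs≤r = +-cancelʳ-≤ s (arcs w) r (subst (arcs w + s ≤_) (sym r+s≡N)
            (Cycle.count-bound N s k′ 0<s (Q w) (Q? w) Q-periodic Q-periodic⁻ (<⇒≤ s<N) N≤ks nocover))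

        size-≤ : N * length F ≤ r * length ℋs
        size-≤ = Family.average-≤ F F-unique F-shape arcs≤r

        -- The equality case

        module Tight (N<ks : N < suc (suc k″) * s) (ge : r * length ℋs ≤ N * length F) where

          module _ {w : List V} (g : Good w) where

            tight : N ≤ arcs w + s
            tight = subst (_≤ arcs w + s) r+s≡N (+-monoˡ-≤ s (Family.average-tight F F-unique F-shape arcs≤r ge g))

            centre : ∃ λ z → Star (rots z w)
            -- The missing complementary arcs start at `a + 1` to `a + s`; these are exactly the
            -- ones containing position `a + s`, so the members present are the arcs through it.
            centre = a + s , star
              where
              a : ℕ
              a = Cycle.Extremal.a N s k′ 0<s (Q w) (Q? w) (Q-periodic g) (Q-periodic⁻ g) (<⇒≤ s<N) N≤ks (nocover g)
                (s≤s z≤n) N<ks tight s<N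
              arc≡ : ∀ u → I (rots (a + s) w) (suc u) r ≡ I w (a + suc u + s) r
              arc≡ u = trans (I-rots w (a + s) (suc u) r) (cong (λ j → I w j r) (lemma a s u))
                where
                lemma : ∀ a s u → a + s + suc u ≡ a + suc u + s
                lemma = solve-∀
              star : Star (rots (a + s) w)
              star (suc u) _ u<N =
                (λ s≤u → subst (_∈ F) (sym (arc≡ u))
                  (Cycle.Extremal.later-present N s k′ 0<s (Q w) (Q? w) (Q-periodic g) (Q-periodic⁻ g) (<⇒≤ s<N) N≤ks (nocover g)
                    (s≤s z≤n) N<ks tight s<N u u<N (≤-pred s≤u))) ,
                (λ I∈ → ≰⇒> λ u<s →
                  Cycle.Extremal.initial-missing N s k′ 0<s (Q w) (Q? w) (Q-periodic g) (Q-periodic⁻ g) (<⇒≤ s<N) N≤ks (nocover g)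
                    (s≤s z≤n) N<ks tight s<N u u<s (subst (_∈ F) (arc≡ u) I∈))

          -- A member of F missing the centre of a star cannot lie in k − 1 consecutive
          -- complementary arcs that avoid the centre.
          no-window : ∀ {w B lo len} → Good w → Star w → B ∈ F → 1 ≤ lo → len ≤ k′ * s →
            ¬ (∀ {v} → v ∈ₛ B → ∃ λ p → lo ≤ p × p < lo + len × p < N × v ≡ seq w p)
          no-window {w} {B} {lo} {len} g star B∈F 1≤lo len≤ B⊆ =
            let x , x∈ = F-kwise f f∈F
                p , lo≤p , p<lo+len , p<N , x≡ = B⊆ (x∈ F.zero)
                i , i≤k″ , bi≤p , p<bi = chain b step k″ (≤-trans (m⊓n≤m _ r) (≤-trans (≤-reflexive (+-identityʳ lo)) lo≤p))
                  (subst (p <_) (sym (b+s k″)) (⊓-pres-m< (≤-trans p<lo+len (≤-by len≤ (lemma lo len k″ s))) p<N))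
            in ∉-opposite-arc g bi≤p p<bi (subst₂ (λ v j → v ∈ₛ I w (b j + s) r) x≡ (toℕ-fromℕ< (s≤s i≤k″))
                 (x∈ (F.suc (fromℕ< (s≤s i≤k″)))))
            where
            lemma : ∀ lo len k″ s → (lo + len) + (s + k″ * s) ≡ (lo + k″ * s + s) + len
            lemma = solve-∀
            -- Cut off at `r = N − s`, the complementary arcs end by position `N`; as `lo ≥ 1`, they
            -- avoid the centre, so their complements belong to `F`.
            b : ℕ → ℕ
            b i = (lo + i * s) ⊓ r
            b+s : ∀ i → b i + s ≡ (lo + i * s + s) ⊓ N
            b+s i = trans (+-distribʳ-⊓ s (lo + i * s) r) (cong ((lo + i * s + s) ⊓_) r+s≡N)
            step : ∀ i → b (suc i) ≤ b i + s
            step i = subst (b (suc i) ≤_) (sym (b+s i)) (⊓-mono-≤ (≤-reflexive (lemma′ lo s i)) r≤N)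
              where
              lemma′ : ∀ lo s i → lo + (s + i * s) ≡ lo + i * s + s
              lemma′ = solve-∀
            f : Fin (suc k′) → Subset (n + n)
            f F.zero = B
            f (F.suc i) = I w (b (toℕ i) + s) r
            f∈F : ∀ i → f i ∈ F
            f∈F F.zero = B∈F
            f∈F (F.suc i) = proj₁ (star (b (toℕ i) + s) (≤-trans 0<s (m≤n+m s _))
              (subst (_≤ N) (sym (b+s (toℕ i))) (m⊓n≤n _ N)))
              (m<n+m s (⊓-glb (≤-trans 1≤lo (m≤m+n lo _)) 0<r))

          -- Room for a window of `r + 1` positions: an arc together with one displaced vertex.
          r<k′s : r < k′ * s
          r<k′s = +-cancelʳ-< s r (k′ * s) (subst₂ _<_ (sym r+s≡N) (+-comm s (k′ * s)) N<ks)

          -- Here also `s = n`, so `2n < k n` forces `k ≥ 3`, and the window may consist of all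
          -- positions but the centre.
          N≤k′s : r ≡ n → N ≤ k′ * s
          N≤k′s refl = subst (λ t → n + n ≤ k′ * t) (sym (m+n∸m≡n n n)) (two k′ (subst (λ t → n + n < t + k′ * t) (m+n∸m≡n n n) N<ks))
            where
            two : ∀ k → n + n < n + k * n → n + n ≤ k * n
            two zero lt = contradiction (≤-trans lt (≤-reflexive (+-identityʳ n))) (≤⇒≯ (m≤m+n n n))
            two (suc zero) lt = contradiction (≤-trans lt (≤-reflexive (cong (n +_) (+-identityʳ n)))) (n≮n (n + n))
            two (suc (suc k)) lt = subst (n + n ≤_) (+-assoc n n (k * n)) (m≤m+n (n + n) (k * n))

          module _ {x ps a b qs} (g : Good (x ∷ ps ++ a ∷ b ∷ qs)) (star : Star (x ∷ ps ++ a ∷ b ∷ qs)) where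

            private
              w w′ : List V
              w = x ∷ ps ++ a ∷ b ∷ qs
              w′ = x ∷ ps ++ b ∷ a ∷ qs
              l : ℕ
              l = suc (length ps)
              g′ : Good w′
              g′ = good-↭ (Perm.++⁺ˡ (x ∷ ps) (swap a b refl)) g
              l+1<n : suc l < n
              l+1<n = subst (suc l <_) (trans (cong suc (sym (length-++ ps))) (proj₁ g)) (s≤s (≤-trans (≤-reflexive (+-comm 2 (length ps)))
                (+-monoʳ-≤ (length ps) (s≤s (s≤s (z≤n {length qs}))))))
              moved : ∀ p → p < N → Moved w w′ l p
              moved = swap-moved (x ∷ ps) a b qs g

            -- Seen in the old word, the arc is an arc of `w` up to displacements by one position at
            -- its ends. It fits into a window of `r + 1` positions avoiding the centre unless both
            -- ends are disturbed; for `r = n`, where this can occur, the window of all other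
            -- positions is used.
            arc-∉ : ∀ j → 1 ≤ j → j + r ≤ N → I w′ j r ∉ F
            arc-∉ j 1≤j j+r≤N I∈F = by-cases (r ≟ n) (j ≟ suc l) (j ≟ suc (n + l))
              where
              within : ∀ {lo len} → 1 ≤ lo → len ≤ k′ * s →
                (∀ {p} → j ≤ p → p < j + r → seq w′ p ≡ seq w p → lo ≤ p × p < lo + len) →
                (∀ {p} → j ≤ p → p < j + r → p ≡ l ⊎ p ≡ n + l → lo ≤ suc p × suc p < lo + len) →
                (∀ {p} → j ≤ suc p → suc p < j + r → p ≡ l ⊎ p ≡ n + l → lo ≤ p × p < lo + len) → Data.Empty.⊥
              within {lo} {len} 1≤lo len≤ fix up′ down′ = no-window g star I∈F 1≤lo len≤ λ v∈ →
                let i , i<r , v≡ = ∈-I⁻ {w′} {j} {r} v∈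
                    p<j+r = +-monoʳ-< j i<r
                    p<N = ≤-trans p<j+r j+r≤N
                    p , lo≤p , p< , p<N′ , e = at (moved (j + i) p<N) (m≤m+n j i) p<j+r p<N
                in p , lo≤p , p< , p<N′ , trans v≡ e
                where
                suc<N : ∀ {p} → p ≡ l ⊎ p ≡ n + l → suc p < N
                suc<N (inj₁ refl) = ≤-trans l+1<n (m≤m+n n n)
                suc<N (inj₂ refl) = subst (_< N) (+-suc n l) (+-monoʳ-< n l+1<n)
                at : ∀ {q} → Moved w w′ l q → j ≤ q → q < j + r → q < N →
                  ∃ λ p → lo ≤ p × p < lo + len × p < N × seq w′ q ≡ seq w p
                at (fixed {q} e) j≤q q< q<N = let lo≤ , <hi = fix j≤q q< e in q , lo≤ , <hi , q<N , e
                at (up {q} at-l e) j≤q q< q<N = let lo≤ , <hi = up′ j≤q q< at-l in suc q , lo≤ , <hi , suc<N at-l , e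
                at (down {q} at-l e) j≤q q< q<N = let lo≤ , <hi = down′ j≤q q< at-l in q , lo≤ , <hi , <-trans (n<1+n q) q<N , e
              l≥1 : ∀ {p} → p ≡ l ⊎ p ≡ n + l → 1 ≤ p
              l≥1 (inj₁ refl) = s≤s z≤n
              l≥1 (inj₂ refl) = ≤-trans (s≤s z≤n) (m≤n+m l n)
              -- The swap moves the arc only at an end lying between the two swapped positions;
              -- for r ≠ n this happens at most at one end.
              at-start : r ≢ n → ∀ {q} → q ≡ l ⊎ q ≡ n + l → j ≡ suc q → Data.Empty.⊥
              at-start r≢n {q} q-l refl = within (l≥1 q-l) r<k′s
                (λ {p} j≤p p< _ → ≤-trans (n≤1+n q) j≤p , subst (p <_) (sym (+-suc q r)) p<)
                (λ {p} j≤p p< p-l → ≤-trans (n≤1+n q) (≤-trans j≤p (n≤1+n p)) ,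
                  subst (suc p <_) (sym (+-suc q r)) (≤∧≢⇒< p< λ e → r≢n (two-ends p-l q-l (cong pred e))))
                (λ {p} j≤p p< _ → ≤-pred j≤p , subst (p <_) (sym (+-suc q r)) (<-trans (n<1+n p) p<))
                where
                two-ends : ∀ {p q} → p ≡ l ⊎ p ≡ n + l → q ≡ l ⊎ q ≡ n + l → p ≡ q + r → r ≡ n
                two-ends (inj₁ refl) (inj₁ refl) e = contradiction e (<⇒≢ (m<m+n l 0<r))
                two-ends (inj₁ refl) (inj₂ refl) e = contradiction e (<⇒≢ (≤-trans (m<m+n l 0<r) (+-monoˡ-≤ r (m≤n+m l n))))
                two-ends (inj₂ refl) (inj₁ refl) e = +-cancelˡ-≡ l r n (trans (sym e) (+-comm n l))
                two-ends (inj₂ refl) (inj₂ refl) e = contradiction e (<⇒≢ (m<m+n (n + l) 0<r))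
              by-cases : Dec (r ≡ n) → Dec (j ≡ suc l) → Dec (j ≡ suc (n + l)) → Data.Empty.⊥
              by-cases (yes r≡n) _ _ = within {1} {N} ≤-refl (N≤k′s r≡n)
                (λ j≤p p< _ → ≤-trans 1≤j j≤p , m<n⇒m<1+n (≤-trans p< j+r≤N))
                (λ j≤p p< _ → s≤s z≤n , s≤s (≤-trans p< j+r≤N))
                (λ {p} j≤p p< p-l → l≥1 p-l , ≤-trans (m<n⇒m<1+n (n<1+n p)) (s≤s (≤-trans (<⇒≤ p<) j+r≤N)))
              by-cases (no r≢n) (yes e) _ = at-start r≢n (inj₁ refl) e
              by-cases (no r≢n) (no _) (yes e) = at-start r≢n (inj₂ refl) e
              by-cases (no _) (no j≢) (no j≢′) = within 1≤j r<k′s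
                (λ {p} j≤p p< _ → j≤p , subst (p <_) (sym (+-suc j r)) (m<n⇒m<1+n p<))
                (λ {p} j≤p p< _ → m≤n⇒m≤1+n j≤p , subst (suc p <_) (sym (+-suc j r)) (s≤s p<))
                (λ {p} j≤p p< p-l → ≤-pred (≤∧≢⇒< j≤p (j≢p p-l)) , subst (p <_) (sym (+-suc j r)) (m<n⇒m<1+n (<-trans (n<1+n p) p<)))
                where
                j≢p : ∀ {p} → p ≡ l ⊎ p ≡ n + l → j ≢ suc p
                j≢p (inj₁ refl) = j≢
                j≢p (inj₂ refl) = j≢′

            -- The swapped word has a centre somewhere. At any position `z` other than 0, some arc
            -- through `z` avoiding position 0 would be a member, against `arc-∉`.
            star-swap : Star w′
            star-swap =
              let z , star′ = centre g′
              in by-cases (z % N) (m%n<n z N) (subst Star (rots-% g′ z) star′)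
              where
              by-cases : ∀ z → z < N → Star (rots z w′) → Star w′
              by-cases zero _ star′ = star′
              by-cases z@(suc _) z<N star′ = ⊥-elim (arc-∉ j (s≤s z≤n) j+r≤N I∈F)
                where
                -- an arc containing position z but not position 0
                j e : ℕ
                j = suc (z ∸ r)
                e = N ∸ z + j
                j+r≤N : j + r ≤ N
                j+r≤N with ≤-total z r
                ... | inj₁ z≤r = subst (λ t → suc t + r ≤ N) (sym (m≤n⇒m∸n≡0 z≤r)) r<N
                ... | inj₂ r≤z = ≤-trans (s≤s (≤-reflexive (m∸n+n≡m r≤z))) z<N
                j≤z : j ≤ z
                j≤z = s≤s (∸-monoʳ-≤ z 0<r)
                z<j+r : z < j + r
                z<j+r = s≤s (subst (z ≤_) (+-comm r (z ∸ r)) (m≤n+m∸n z r))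
                z+e : z + e ≡ N + j
                z+e = trans (sym (+-assoc z (N ∸ z) j)) (cong (_+ j) (m+[n∸m]≡n (<⇒≤ z<N)))
                e≤N : e ≤ N
                e≤N = +-cancelˡ-≤ z e N (subst₂ _≤_ (sym z+e) (+-comm N z) (+-monoʳ-≤ N j≤z))
                s<e : s < e
                s<e = +-cancelˡ-< z s e (subst (z + s <_) (sym z+e) (subst (z + s <_) eq (+-monoˡ-< s z<j+r)))
                  where
                  eq : j + r + s ≡ N + j
                  eq = trans (+-assoc j r s) (trans (cong (j +_) r+s≡N) (+-comm j N))
                I∈F : I w′ j r ∈ F
                I∈F = subst (_∈ F) (trans (I-rots w′ z e r) (trans (cong (λ i → I w′ i r) z+e) (I-N+ g′ j r)))
                  (proj₁ (star′ e (≤-trans (s≤s z≤n) (m≤n+m j (N ∸ z))) e≤N) s<e)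

          -- The prefix `ps` collects the letters already passed by `prep`, so that a swap deep
          -- inside the list is a swap in the whole word.
          star-↭ : ∀ x ps {xs ys} → xs ↭ ys → Good (x ∷ ps ++ xs) → Star (x ∷ ps ++ xs) → Star (x ∷ ps ++ ys)
          star-↭ x ps refl g star = star
          star-↭ x ps (prep {xs} {ys} a p) g star = subst (λ u → Star (x ∷ u)) (++-assoc ps [ a ] ys)
            (star-↭ x (ps ++ [ a ]) p (subst (λ u → Good (x ∷ u)) (sym (++-assoc ps [ a ] xs)) g)
              (subst (λ u → Star (x ∷ u)) (sym (++-assoc ps [ a ] xs)) star))
          star-↭ x ps (swap {xs} {ys} a b p) g star = star-swap {x} {ps} {a} {b} {ys}
            (good-↭ (Perm.++⁺ˡ (x ∷ ps) (prep a (prep b p))) g)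
            (subst (λ u → Star (x ∷ u)) (++-assoc ps (a ∷ b ∷ []) ys)
              (star-↭ x (ps ++ a ∷ b ∷ []) p (subst (λ u → Good (x ∷ u)) (sym (++-assoc ps (a ∷ b ∷ []) xs)) g)
                (subst (λ u → Star (x ∷ u)) (sym (++-assoc ps (a ∷ b ∷ []) xs)) star)))
          star-↭ x ps (_↭_.trans p q) g star = star-↭ x ps q (good-↭ (Perm.++⁺ˡ (x ∷ ps) p) g) (star-↭ x ps p g star)

          initial-star : ∃ λ x → ∃ λ xs → Good (x ∷ xs) × Star (x ∷ xs)
          initial-star =
            let z , star = centre some-good
            in uncons (rots z some-word) (good-rots z some-good) star
            where
            uncons : ∀ w → Good w → Star w → ∃ λ x → ∃ λ xs → Good (x ∷ xs) × Star (x ∷ xs)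
            uncons [] (l , _) _ = contradiction (subst (0 <_) (sym l) 0<n) λ ()
            uncons (x ∷ xs) g star = x , xs , g , star

          x₀ : V
          x₀ = proj₁ initial-star

          -- Reordering the letters behind `x₀` makes `A` an arc while `x₀` remains the centre.
          members : ∀ {A} → ∣ A ∣ ≡ r → (Ind A × x₀ ∈ₛ A) ⊎ (Ind (∁ A) × x₀ ∉ₛ A) → (x₀ ∈ₛ A → A ∈ F) × (A ∈ F → x₀ ∈ₛ A)
          members e p =
            let xs , g , star = proj₂ initial-star
                ys , perm , j , A≡ = interval g e p
                to , from = star-∈ (good-↭ (prep x₀ perm) g) (star-↭ x₀ [] perm g star) j
            in (λ x∈ → subst (_∈ F) (sym A≡) (to (subst (x₀ ∈ₛ_) A≡ x∈))) ,
               (λ A∈ → subst (x₀ ∈ₛ_) (sym A≡) (from (subst (_∈ F) A≡ A∈)))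

          ℋₓs : List (Subset (n + n))
          ℋₓs = filter (x₀ ∈ₛ?_) ℋs

          ℋₓs-unique : Unique ℋₓs
          ℋₓs-unique = Uniq.filter⁺ (x₀ ∈ₛ?_) (sets-unique r r≤N)

          ∈-ℋₓs⁻ : ∀ {A} → A ∈ ℋₓs → (∣ A ∣ ≡ r × Shape r A) × x₀ ∈ₛ A
          ∈-ℋₓs⁻ A∈ = let A∈ℋs , x∈ = ∈-filter⁻ (x₀ ∈ₛ?_) {xs = ℋs} A∈ in ∈-sets⁻ r r≤N A∈ℋs , x∈

          ∈-ℋₓs⁺ : ∀ {A} → ∣ A ∣ ≡ r → Shape r A → x₀ ∈ₛ A → A ∈ ℋₓs
          ∈-ℋₓs⁺ e sh x∈ = ∈-filter⁺ (x₀ ∈ₛ?_) (∈-sets⁺ r r≤N e sh) x∈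

          length≡ : length F ≡ length ℋₓs
          length≡ = *-cancelˡ-≡ (length F) (length ℋₓs) N (trans (≤-antisym size-≤ ge)
            (sym (star-size {ℋₓs} {x₀} ℋₓs-unique (λ A∈ → proj₁ (∈-ℋₓs⁻ A∈)) (λ A∈ → proj₂ (∈-ℋₓs⁻ A∈)) ∈-ℋₓs⁺)))

          -- `members` yields one inclusion for each range of `r`; `length≡` upgrades it to
          -- equality.
          F↭ℋₓs : F ↭ ℋₓs
          F↭ℋₓs = by-cases (r ≤? n)
            where
            ⊇ : r ≤ n → ∀ {A} → ∣ A ∣ ≡ r × Shape r A → x₀ ∈ₛ A → A ∈ F
            ⊇ _ (e , inj₁ (_ , ind)) x∈ = proj₁ (members e (inj₁ (ind , x∈))) x∈
            ⊇ r≤n (_ , inj₂ (n<r , _)) _ = contradiction r≤n (<⇒≱ n<r)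
            ⊆ : ¬ r ≤ n → ∀ {A} → ∣ A ∣ ≡ r × Shape r A → A ∈ F → x₀ ∈ₛ A
            ⊆ r≰n (_ , inj₁ (r≤n , _)) _ = contradiction r≤n r≰n
            ⊆ _ {A} (e , inj₂ (_ , ind)) A∈ =
              decidable-stable (x₀ ∈ₛ? A) λ x∉ → x∉ (proj₂ (members e (inj₂ (ind , x∉))) A∈)
            by-cases : Dec (r ≤ n) → F ↭ ℋₓs
            by-cases (yes r≤n) = unique-⊆-length≥⇒↭ ℋₓs-unique
              (λ A∈ → ⊇ r≤n (proj₁ (∈-ℋₓs⁻ A∈)) (proj₂ (∈-ℋₓs⁻ A∈))) (≤-reflexive length≡)
            by-cases (no r≰n) = ↭-sym (unique-⊆-length≥⇒↭ F-unique
              (λ A∈ → ∈-ℋₓs⁺ (proj₁ (F-shape A∈)) (proj₂ (F-shape A∈)) (⊆ r≰n (F-shape A∈) A∈)) (≤-reflexive (sym length≡)))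

          centre-star : ∃ λ x → ∀ A → (A ∈ F ⇔ ℋₓ n r x A)
          centre-star = x₀ , λ A → mk⇔
            (λ A∈ → let (e , sh) , x∈ = ∈-ℋₓs⁻ (Perm.∈-resp-↭ F↭ℋₓs A∈) in Shape⇒ℋ e sh , x∈)
            (λ (h , x∈) → let e , sh = ℋ⇒Shape h in Perm.∈-resp-↭ (↭-sym F↭ℋₓs) (∈-ℋₓs⁺ e sh x∈))

-- The bound

-- Proved from Pascal's rule; it trades the factor `r` of `r * |ℋʳ|` for the factor `n`.
absorption : ∀ n k → suc k * (suc n C suc k) ≡ suc n * (n C k)
absorption zero zero = refl
absorption zero (suc k) = trans (cong (suc (suc k) *_) (k>n⇒nCk≡0 {1} {2 + k} (s≤s (s≤s z≤n))))
  (trans (*-zeroʳ (2 + k)) (sym (cong (1 *_) (k>n⇒nCk≡0 {0} {suc k} (s≤s z≤n)))))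
absorption (suc n) zero = begin
  1 * (suc (suc n) C 1) ≡⟨ cong (1 *_) (nCk+nC[k+1]≡[n+1]C[k+1] (suc n) 0) ⟨
  1 * (suc n C 0 + suc n C 1) ≡⟨ cong₂ (λ x y → 1 * (x + y)) (nC0≡1 (suc n)) (trans (sym (*-identityˡ _)) (absorption n 0)) ⟩
  1 * (1 + suc n * (n C 0)) ≡⟨ cong (λ x → 1 * (1 + suc n * x)) (nC0≡1 n) ⟩
  1 * (1 + suc n * 1) ≡⟨ lemma n ⟩
  suc (suc n) * 1 ≡⟨ cong (suc (suc n) *_) (nC0≡1 (suc n)) ⟨
  suc (suc n) * (suc n C 0) ∎
  where
  open ≡-Reasoning
  lemma : ∀ n → 1 * (1 + suc n * 1) ≡ suc (suc n) * 1
  lemma = solve-∀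
absorption (suc n) (suc k) = begin
  suc (suc k) * (suc (suc n) C suc (suc k)) ≡⟨ cong (suc (suc k) *_) (nCk+nC[k+1]≡[n+1]C[k+1] (suc n) (suc k)) ⟨
  suc (suc k) * (b + suc n C suc (suc k)) ≡⟨ *-distribˡ-+ (suc (suc k)) b _ ⟩
  suc (suc k) * b + suc (suc k) * (suc n C suc (suc k)) ≡⟨ cong (suc (suc k) * b +_) (absorption n (suc k)) ⟩
  (b + suc k * b) + suc n * (n C suc k) ≡⟨ cong (λ x → (b + x) + suc n * (n C suc k)) (absorption n k) ⟩
  (b + suc n * (n C k)) + suc n * (n C suc k) ≡⟨ lemma b n (n C k) (n C suc k) ⟩
  b + suc n * (n C k + n C suc k) ≡⟨ cong (λ x → b + suc n * x) (nCk+nC[k+1]≡[n+1]C[k+1] n k) ⟩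
  suc (suc n) * b ∎
  where
  open ≡-Reasoning
  b = suc n C suc k
  lemma : ∀ b n x y → (b + suc n * x) + suc n * y ≡ b + suc n * (x + y)
  lemma = solve-∀

module _ (m r : ℕ) (0<r : 0 < r) (r<N : r < suc m + suc m) where

  private
    n = suc m

  -- The bound is the share `r / N` of ℋʳ, the proportion of its members that contain a fixed
  -- vertex.
  N*bound≡r*∣sets∣ : (n + n) * bound n r ≡ r * length (Matching.sets n r (<⇒≤ r<N))
  N*bound≡r*∣sets∣ with r ≤ᵇ n in eq
  N*bound≡r*∣sets∣ | true = trans (small r 0<r) (cong (r *_) (sym (Matching.length-sets-small n r (<⇒≤ r<N) (≤ᵇ⇒≤ r n (subst T (sym eq) _)))))
    where
    small : ∀ r → 0 < r → (n + n) * (2 ^ (r ∸ 1) * (m C (r ∸ 1))) ≡ r * (2 ^ r * (n C r))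
    small (suc q) _ = begin
      (n + n) * (2 ^ q * (m C q)) ≡⟨ lemma₁ n (2 ^ q) (m C q) ⟩
      2 * 2 ^ q * (n * (m C q)) ≡⟨ cong (2 * 2 ^ q *_) (absorption m q) ⟨
      2 * 2 ^ q * (suc q * (n C suc q)) ≡⟨ lemma₂ (suc q) (2 ^ q) (n C suc q) ⟩
      suc q * (2 ^ suc q * (n C suc q)) ∎
      where
      open ≡-Reasoning
      lemma₁ : ∀ n x c → (n + n) * (x * c) ≡ 2 * x * (n * c)
      lemma₁ = solve-∀
      lemma₂ : ∀ r x c → 2 * x * (r * c) ≡ r * (2 * x * c)
      lemma₂ = solve-∀
  N*bound≡r*∣sets∣ | false = large (m≤n⇒∃[o]m+o≡n n<r) (m≤n⇒∃[o]m+o≡n r<N)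
    where
    n<r : n < r
    n<r = ≰⇒> λ r≤n → subst T eq (≤⇒≤ᵇ r≤n)
    -- d = r − n − 1 and t = 2n − r − 1
    large : (∃ λ d → suc n + d ≡ r) → (∃ λ t → suc r + t ≡ n + n) →
      (n + n) * (2 ^ (2 * n ∸ r) * (m C (r ∸ n ∸ 1)) + 2 ^ (2 * n ∸ r ∸ 1) * (m C (r ∸ n)))
      ≡ r * length (Matching.sets n r (<⇒≤ r<N))
    large (d , e) (t , f) = begin
      (n + n) * (2 ^ (2 * n ∸ r) * (m C (r ∸ n ∸ 1)) + 2 ^ (2 * n ∸ r ∸ 1) * (m C (r ∸ n)))
        ≡⟨ cong₂ (λ x y → (n + n) * (2 ^ x * (m C (y ∸ 1)) + 2 ^ (x ∸ 1) * (m C y))) 2n∸r r∸n ⟩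
      (n + n) * (2 ^ suc t * (m C d) + 2 ^ t * (m C suc d)) ≡⟨ lemma₁ n (2 ^ t) (m C d) (m C suc d) ⟩
      -- As `(d + 1) + (t + 1) = n`, absorption and symmetry make both terms multiples of
      -- `n C suc t`; the coefficients add up to `2 (d + 1) + (t + 1) = r`.
      2 ^ suc t * (2 * (n * (m C d)) + n * (m C suc d)) ≡⟨ cong₂ (λ x y → 2 ^ suc t * (2 * x + y)) (trans (sym (absorption m d)) (cong (suc d *_) Cd≡Ct)) (trans (cong (n *_) md≡mt) (sym (absorption m t))) ⟩
      2 ^ suc t * (2 * (suc d * c) + suc t * c) ≡⟨ lemma₂ (2 ^ suc t) d t c ⟩
      (suc (d + t) + suc (suc d)) * (2 ^ suc t * c) ≡⟨ cong (_* (2 ^ suc t * c)) r≡ ⟩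
      r * (2 ^ suc t * c)
        ≡⟨ cong (r *_) (trans (Matching.length-sets-large n r (<⇒≤ r<N) n<r) (cong (λ x → 2 ^ x * (n C x)) N∸r)) ⟨
      r * length (Matching.sets n r (<⇒≤ r<N)) ∎
      where
      open ≡-Reasoning
      c = n C suc t
      2n∸r : 2 * n ∸ r ≡ suc t
      2n∸r = trans (cong (_∸ r) (trans (cong (n +_) (+-identityʳ n)) (trans (sym f) (sym (+-suc r t))))) (m+n∸m≡n r (suc t))
      N∸r : n + n ∸ r ≡ suc t
      N∸r = trans (cong (_∸ r) (trans (sym f) (sym (+-suc r t)))) (m+n∸m≡n r (suc t))
      r∸n : r ∸ n ≡ suc d
      r∸n = trans (cong (_∸ n) (trans (sym e) (sym (+-suc n d)))) (m+n∸m≡n n (suc d))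
      m≡ : m ≡ suc (d + t)
      m≡ = +-cancelˡ-≡ (suc n) m (suc (d + t)) (begin
        suc (n + m) ≡⟨ +-suc n m ⟨
        n + n ≡⟨ f ⟨
        suc r + t ≡⟨ cong (λ x → suc x + t) (sym e) ⟩
        suc (suc n + d) + t ≡⟨ lemma n d t ⟩
        suc n + suc (d + t) ∎)
        where
        lemma : ∀ n d t → suc (suc n + d) + t ≡ suc n + suc (d + t)
        lemma = solve-∀
      r≡ : suc (d + t) + suc (suc d) ≡ r
      r≡ = trans (cong (_+ suc (suc d)) (sym m≡)) (trans (+-suc m (suc d)) (trans (cong suc (+-suc m d)) e))
      Cd≡Ct : n C suc d ≡ c
      Cd≡Ct = trans (nCk≡nC[n∸k] {suc d} {n} (s≤s (subst (d ≤_) (sym m≡) (m≤n⇒m≤1+n (m≤m+n d t)))))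
        (cong (n C_) (trans (cong (_∸ d) m≡) (trans (cong (_∸ d) (sym (+-suc d t))) (m+n∸m≡n d (suc t)))))
      md≡mt : m C suc d ≡ m C t
      md≡mt = trans (nCk≡nC[n∸k] {suc d} {m} (subst (suc d ≤_) (sym m≡) (s≤s (m≤m+n d t))))
        (cong (m C_) (trans (cong (_∸ suc d) m≡) (m+n∸m≡n d t)))
      lemma₁ : ∀ n x y z → (n + n) * (2 * x * y + x * z) ≡ 2 * x * (2 * (n * y) + n * z)
      lemma₁ = solve-∀
      lemma₂ : ∀ x d t c → x * (2 * (suc d * c) + suc t * c) ≡ (suc (d + t) + suc (suc d)) * (x * c)
      lemma₂ = solve-∀

-- The condition on r in terms of complementary arcs

module _ {k′ m r : ℕ} (kr≤ : suc k′ * r ≤ k′ * (2 * suc m)) where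

  private
    n N : ℕ
    n = suc m
    N = n + n

    2*n≡N : 2 * n ≡ N
    2*n≡N = cong (n +_) (+-identityʳ n)

    kr≤k′N : suc k′ * r ≤ k′ * N
    kr≤k′N = subst (λ t → suc k′ * r ≤ k′ * t) 2*n≡N kr≤

  r<N : r < N
  r<N = ≰⇒> λ N≤r → contradiction (≤-trans (*-monoʳ-≤ (suc k′) N≤r) kr≤k′N) (<⇒≱ (m<n+m (k′ * N) (s≤s z≤n)))

  private
    ks+kr : suc k′ * (N ∸ r) + suc k′ * r ≡ N + k′ * N
    ks+kr = trans (sym (*-distribˡ-+ (suc k′) (N ∸ r) r)) (cong (suc k′ *_) (m∸n+n≡m (<⇒≤ r<N)))

  -- Since `k s + k r = N + (k − 1) N`, the condition on `r` says precisely that k complementary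
  -- arcs are long enough to go round.
  N≤ks : N ≤ suc k′ * (N ∸ r)
  N≤ks = +-cancelʳ-≤ (suc k′ * r) N _ (≤-trans (+-monoʳ-≤ N kr≤k′N) (≤-reflexive (sym ks+kr)))

  N<ks : suc k′ * r < k′ * (2 * n) → N < suc k′ * (N ∸ r)
  N<ks kr< = +-cancelʳ-< (suc k′ * r) N _
    (≤-trans (+-monoʳ-< N (subst (λ t → suc k′ * r < k′ * t) 2*n≡N kr<)) (≤-reflexive (sym ks+kr)))

theorem1p4 : (k n r : ℕ) → 2 ≤ k → 1 ≤ n → 1 ≤ r → k * r ≤ (k ∸ 1) * (2 * n) →
    (F : List (Subset (n + n))) → Unique F → All (ℋ n r) F → KWiseIntersecting k F →
    (length F ≤ bound n r)
    × (k * r < (k ∸ 1) * (2 * n) →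
    (length F ≡ bound n r ⇔ ∃ λ (x : Fin (n + n)) → ∀ A → (A ∈ F ⇔ ℋₓ n r x A)))
theorem1p4 (suc (suc k″)) n@(suc m) r _ _ 0<r kr≤ F F-unique F-ℋ F-kwise =
  *-cancelˡ-≤ N (subst (N * length F ≤_) (sym total) size-≤) , λ kr< → mk⇔ (⇒ kr<) ⇐
  where
  N : ℕ
  N = n + n
  r<N′ : r < N
  r<N′ = r<N {suc k″} {m} {r} kr≤
  ℋs : List (Subset (n + n))
  ℋs = Matching.sets n r (<⇒≤ r<N′)
  total : N * bound n r ≡ r * length ℋs
  total = N*bound≡r*∣sets∣ m r 0<r r<N′
  F-shape : ∀ {A} → A ∈ F → ∣ A ∣ ≡ r × Matching.Shape n r A
  F-shape A∈ = Matching.ℋ⇒Shape n (All.lookup F-ℋ A∈)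
  size-≤ : N * length F ≤ r * length ℋs
  size-≤ = Matching.Words.Averaging.Intersecting.size-≤ n F.zero (s≤s z≤n) r 0<r r<N′ k″ F F-unique F-shape F-kwise (N≤ks {suc k″} {m} {r} kr≤)
  ⇐ : (∃ λ x → ∀ A → A ∈ F ⇔ ℋₓ n r x A) → length F ≡ bound n r
  ⇐ (x , F⇔) = *-cancelˡ-≡ (length F) (bound n r) N (trans
    (Matching.Words.Averaging.star-size n F.zero (s≤s z≤n) r 0<r r<N′ {F} {x} F-unique F-shape
      (λ {A} A∈ → proj₂ (Equivalence.to (F⇔ A) A∈))
      (λ {A} e sh x∈ → Equivalence.from (F⇔ A) (Matching.Shape⇒ℋ n e sh , x∈)))
    (sym total))
  ⇒ : suc (suc k″) * r < suc k″ * (2 * n) → length F ≡ bound n r → ∃ λ x → ∀ A → A ∈ F ⇔ ℋₓ n r x A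
  ⇒ kr< e = Matching.Words.Averaging.Intersecting.Tight.centre-star n F.zero (s≤s z≤n) r 0<r r<N′ k″ F F-unique F-shape F-kwise (N≤ks {suc k″} {m} {r} kr≤)
    (N<ks {suc k″} {m} {r} kr≤ kr<) (≤-reflexive (trans (sym total) (cong (N *_) (sym e))))
theorem1p4 (suc zero) _ _ (s≤s ())
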